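{- Let $A=\{\sigma_1,\dots,\sigma_d\}$ be a permutation group that is a subgroup of $S_n$. (1) If $A$ is permutation summable, then $A$ is exact. (2) If the toric ideal $I_A$ associated to $A$ has a quadratically generated Gröbner basis with respect to every reverse lexicographic ordering $\prec$, then $A$ is exact.
   Context: $A$ is identified with the set of $n\times n$ permutation matrices $\{P_{\sigma_1},\dots,P_{\sigma_d}\}\subseteq\mathbb{Z}^{n\times n}$, a finite real variety in $\mathbb{R}^{n\times n}$. Permutation summable: for any $P_1,\dots,P_m\in A$ (repetitions allowed) satisfying $\sum_{i=1}^mP_i-I\ge0$ entrywise ($I$ the identity matrix), the matrix $\sum_{i=1}^mP_i-I$ is also a sum of permutation matrices in $A$ (repetitions and the empty sum allowed). Toric ideal: $I_A$ is the kernel of the $\mathbb{C}$-algebra homomorphism $\pi:\mathbb{C}[x_{\sigma_1},\dots,x_{\sigma_d}]\to\mathbb{C}[t_{jk}:1\le j,k\le n]$, $\pi(x_{\sigma_i})=\prod_{1\le j,k\le n}t_{jk}^{(P_{\sigma_i})_{jk}}$. A reverse lexicographic ordering means a (graded) reverse lexicographic term order associated to some ordering of the variables $x_{\sigma_1},\dots,x_{\sigma_d}$. "Quadratically generated" means consisting of polynomials of degree two. Exact: let $I\subseteq\mathbb{R}[P_{i,j}:1\le i,j\le n]$ be the (real radical) ideal of all polynomials vanishing on the set of matrices $A$. A polynomial $f$ is $1$-sos mod $I$ if there are polynomials $h_1,\dots,h_r$ of degree at most $1$ with $f-\sum_ih_i^2\in I$. The first theta body is $TH_1(I)=\{x\in\mathbb{R}^{n\times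 n}: f(x)\ge0\text{ for every polynomial }f\text{ of degree at most }1\text{ that is }1\text{ -sos mod }I\}$. $A$ is exact if $\mathrm{conv}(A)=TH_1(I)$. -}

module Defs where

open import Algebra.Bundles using (CommutativeRing; RawRing; RawSemiring)
import Algebra.Definitions.RawSemiring as SemiringOps
open import Data.Bool.Base using (if_then_else_)
open import Data.Fin.Base as Fin using (Fin; combine; remQuot)
open import Data.Fin.Permutation as Perm using (Permutation′; _⟨$⟩ʳ_; _∘ₚ_; flip)
import Data.Fin.Properties as Fin
open import Data.Integer.Base as ℤ using (ℤ)
open import Data.List.Base using (List; []; _∷_; _++_; map; foldr; cartesianProductWith)
open import Data.List.Membership.Propositional using (_∈_)
open import Data.Nat.Base as ℕ using (ℕ)
import Data.Nat.Properties as ℕ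
open import Data.Product.Base using (Σ-syntax; ∃; ∃-syntax; _×_; _,_; uncurry; map₁)
open import Data.Sum.Base using (_⊎_)
open import Data.Vec.Base as Vec using (Vec; lookup; zipWith; replicate; _[_]≔_)
open import Data.Vec.Properties using (≡-dec)
open import Level using (Level; 0ℓ; _⊔_) renaming (suc to lsuc)
open import Relation.Binary.Core using (Rel)
open import Relation.Binary.PropositionalEquality.Core using (_≡_)
open import Relation.Binary.Structures using (IsDecTotalOrder)
open import Relation.Nullary using (¬_; does)
open import Relation.Unary using (Pred; _≐_)

private
  variable
    a ℓ : Level
    d n k : ℕ

-- The library has no real numbers.  ℝ is characterised, uniquely up to
-- isomorphism, as the Dedekind-complete ordered field; equality is a setoid
-- equality so that Cauchy sequences form a model.  Decidability of the order
-- is the classical reading of trichotomy.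
record CompleteOrderedField : Set₁ where
  infix 4 _≤_
  field
    commutativeRing : CommutativeRing 0ℓ 0ℓ

  open CommutativeRing commutativeRing public

  field
    _≤_             : Rel Carrier 0ℓ
    isDecTotalOrder : IsDecTotalOrder _≈_ _≤_
    1≉0             : ¬ (1# ≈ 0#)
    inverse         : ∀ x → ¬ (x ≈ 0#) → ∃[ y ] x * y ≈ 1#
    +-monoˡ-≤       : ∀ z {x y} → x ≤ y → x + z ≤ y + z
    *-nonNegative   : ∀ {x y} → 0# ≤ x → 0# ≤ y → 0# ≤ x * y

  UpperBound : Pred Carrier 0ℓ → Pred Carrier 0ℓ
  UpperBound S u = ∀ x → S x → x ≤ u

  field
    supremum : ∀ (S : Pred Carrier 0ℓ) → ∃ S → ∃ (UpperBound S) →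
               ∃[ s ] UpperBound S s × (∀ u → UpperBound S u → s ≤ u)

-- ℂ = ℝ[i], with (x , y) standing for x + iy.
complexRing : CompleteOrderedField → RawRing 0ℓ 0ℓ
complexRing ℝ = record
  { Carrier = Carrier × Carrier
  ; _≈_     = λ (x , y) (u , v) → x ≈ u × y ≈ v
  ; _+_     = λ (x , y) (u , v) → x + u , y + v
  ; _*_     = λ (x , y) (u , v) → x * u - y * v , x * v + y * u
  ; -_      = λ (x , y) → - x , - y
  ; 0#      = 0# , 0#
  ; 1#      = 1# , 0#
  }
  where open CompleteOrderedField ℝ

Monomial : ℕ → Set
Monomial k = Vec ℕ k

degree : Monomial k → ℕ
degree = Vec.sum

module Polynomial (K : RawRing a ℓ) where
  private module K = RawRing K

  -- K[x₀,…,xₖ₋₁] as finite lists of terms; a monomial may occur repeatedly,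
  -- so polynomials are compared through their coefficients.
  Poly : ℕ → Set a
  Poly k = List (K.Carrier × Monomial k)

  coefficient : Poly k → Monomial k → K.Carrier
  coefficient p m =
    foldr (λ (c , e) s → if does (≡-dec ℕ._≟_ e m) then c K.+ s else s) K.0# p

  constant : K.Carrier → Poly k
  constant {k} c = (c , replicate k 0) ∷ []

  monomial : Monomial k → Poly k
  monomial m = (K.1# , m) ∷ []

  var : Fin k → Poly k
  var {k} i = monomial (replicate k 0 [ i ]≔ 1)

  polyRing : ℕ → RawRing a ℓ
  polyRing k = record
    { Carrier = Poly k
    ; _≈_     = λ p q → ∀ m → coefficient p m K.≈ coefficient q m
    ; _+_     = _++_
    ; _*_     = cartesianProductWith
                  (λ (c , e) (c′ , e′) → c K.* c′ , zipWith ℕ._+_ e e′)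
    ; -_      = map (map₁ K.-_)
    ; 0#      = []
    ; 1#      = constant K.1#
    }

  Occurs : Poly k → Pred (Monomial k) ℓ
  Occurs p m = ¬ (coefficient p m K.≈ K.0#)

  DegreeAtMost : ℕ → Pred (Poly k) ℓ
  DegreeAtMost b p = ∀ m → Occurs p m → degree m ℕ.≤ b

  HasDegree : ℕ → Pred (Poly k) ℓ
  HasDegree b p = DegreeAtMost b p × ∃[ m ] degree m ≡ b × Occurs p m

  -- Extends ι on coefficients and xᵢ ↦ sᵢ to polynomials.
  evaluate : ∀ {b ℓ′} (S : RawSemiring b ℓ′) →
             (K.Carrier → RawSemiring.Carrier S) →
             (Fin k → RawSemiring.Carrier S) → Poly k → RawSemiring.Carrier S
  evaluate S ι s =
    foldr (λ (c , e) t → ι c * product (λ i → s i ^ lookup e i) + t) 0#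
    where
    open RawSemiring S
    open SemiringOps S using (product; _^_)

  module _ {k : ℕ} where
    open RawRing (polyRing k)
    open SemiringOps rawSemiring using (sum)

    -- The ideal generated by S.
    ⟨_⟩ : ∀ {p} → Pred (Poly k) p → Pred (Poly k) (a ⊔ ℓ ⊔ p)
    ⟨ S ⟩ f = ∃[ r ] Σ[ q ∈ (Fin r → Poly k) ] Σ[ g ∈ (Fin r → Poly k) ]
                (∀ i → S (g i)) × f ≈ sum (λ i → q i * g i)

    module _ (_≺_ : Rel (Monomial k) 0ℓ) where

      IsInitialMonomial : Poly k → Pred (Monomial k) ℓ
      IsInitialMonomial f m =
        Occurs f m × (∀ m′ → Occurs f m′ → m′ ≡ m ⊎ m′ ≺ m)

      initialIdeal : ∀ {p} → Pred (Poly k) p → Pred (Poly k) (a ⊔ ℓ ⊔ p)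
      initialIdeal S =
        ⟨ (λ h → ∃[ f ] S f × ∃[ m ] IsInitialMonomial f m × h ≈ monomial m) ⟩

      IsGröbnerBasis : ∀ {p} → List (Poly k) → Pred (Poly k) p → Set (a ⊔ ℓ ⊔ p)
      IsGröbnerBasis G I =
        (∀ g → g ∈ G → I g) × (initialIdeal (_∈ G) ≐ initialIdeal I)

      HasQuadraticGröbnerBasis : ∀ {p} → Pred (Poly k) p → Set (a ⊔ ℓ ⊔ p)
      HasQuadraticGröbnerBasis I =
        ∃[ G ] IsGröbnerBasis G I × (∀ g → g ∈ G → HasDegree 2 g)

-- The graded reverse lexicographic order for the ordering
-- x_{ρ(0)} ≻ x_{ρ(1)} ≻ … ≻ x_{ρ(k-1)} of the variables.
revLex : Permutation′ k → Rel (Monomial k) 0ℓ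
revLex ρ a b =
  degree a ℕ.< degree b ⊎
  (degree a ≡ degree b ×
   ∃[ i ] lookup b (ρ ⟨$⟩ʳ i) ℕ.< lookup a (ρ ⟨$⟩ʳ i) ×
          (∀ j → i Fin.< j → lookup a (ρ ⟨$⟩ʳ j) ≡ lookup b (ρ ⟨$⟩ʳ j)))

Matrix : Set a → ℕ → Set a
Matrix X n = Fin n → Fin n → X

-- The matrix sending the basis vector e_k to e_{σ(k)}.
permMatrix : (S : RawSemiring a ℓ) → Permutation′ n → Matrix (RawSemiring.Carrier S) n
permMatrix S σ j k = if does (σ ⟨$⟩ʳ k Fin.≟ j) then 1# else 0#
  where open RawSemiring S

record IsPermutationGroup {d n} (σ : Fin d → Permutation′ n) : Set where
  field
    distinct  : ∀ i j → σ i Perm.≈ σ j → i ≡ j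
    id-closed : ∃[ i ] σ i Perm.≈ Perm.id
    ∘-closed  : ∀ i j → ∃[ l ] σ l Perm.≈ (σ i ∘ₚ σ j)
    ⁻¹-closed : ∀ i → ∃[ l ] σ l Perm.≈ flip (σ i)

PermutationSummable : (Fin d → Permutation′ n) → Set
PermutationSummable {d} {n} σ =
  ∀ m (τ : Fin m → Fin d) →
  (∀ j k → ℤ.0ℤ ℤ.≤ total τ j k ℤ.- P Perm.id j k) →
  ∃[ l ] Σ[ υ ∈ (Fin l → Fin d) ]
    (∀ j k → total τ j k ℤ.- P Perm.id j k ≡ total υ j k)
  where
  P : Permutation′ n → Matrix ℤ n
  P = permMatrix ℤ.+-*-rawSemiring

  total : ∀ {m} → (Fin m → Fin d) → Matrix ℤ n
  total τ j k = SemiringOps.sum ℤ.+-*-rawSemiring (λ i → P (σ (τ i)) j k)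

module _ (ℝ : CompleteOrderedField) where
  private
    module ℝ = CompleteOrderedField ℝ
    module ℝ[X] = Polynomial ℝ.rawRing
    module ℂ[X] = Polynomial (complexRing ℝ)

  module _ {n : ℕ} where

    -- The variable P_{j,k} of ℝ[P_{j,k}] has index combine j k.
    evalMatrix : Matrix ℝ.Carrier n → ℝ[X].Poly (n ℕ.* n) → ℝ.Carrier
    evalMatrix X = ℝ[X].evaluate (RawRing.rawSemiring ℝ.rawRing) (λ c → c)
                     (λ v → uncurry X (remQuot n v))

    vanishingIdeal : Pred (Matrix ℝ.Carrier n) 0ℓ → Pred (ℝ[X].Poly (n ℕ.* n)) 0ℓ
    vanishingIdeal S f = ∀ X → S X → evalMatrix X f ℝ.≈ ℝ.0#

    conv : Pred (Matrix ℝ.Carrier n) 0ℓ → Pred (Matrix ℝ.Carrier n) 0ℓ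
    conv S X =
      ∃[ r ] Σ[ Y ∈ (Fin r → Matrix ℝ.Carrier n) ] Σ[ w ∈ (Fin r → ℝ.Carrier) ]
        (∀ i → S (Y i)) ×
        (∀ i → ℝ.0# ℝ.≤ w i) ×
        sum w ℝ.≈ ℝ.1# ×
        (∀ j k → X j k ℝ.≈ sum (λ i → w i ℝ.* Y i j k))
      where open SemiringOps (RawRing.rawSemiring ℝ.rawRing) using (sum)

    module _ (I : Pred (ℝ[X].Poly (n ℕ.* n)) 0ℓ) where
      open RawRing (ℝ[X].polyRing (n ℕ.* n)) using (_+_; _*_; -_; rawSemiring)
      open SemiringOps rawSemiring using (sum)

      1-SOSMod : Pred (ℝ[X].Poly (n ℕ.* n)) 0ℓ
      1-SOSMod f =
        ∃[ r ] Σ[ h ∈ (Fin r → ℝ[X].Poly (n ℕ.* n)) ]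
          (∀ i → ℝ[X].DegreeAtMost 1 (h i)) ×
          I (f + (- sum (λ i → h i * h i)))

      TH₁ : Pred (Matrix ℝ.Carrier n) 0ℓ
      TH₁ X = ∀ f → ℝ[X].DegreeAtMost 1 f → 1-SOSMod f → ℝ.0# ℝ.≤ evalMatrix X f

  module _ {d n} (σ : Fin d → Permutation′ n) where

    permMatrices : Pred (Matrix ℝ.Carrier n) 0ℓ
    permMatrices X =
      ∃[ i ] (∀ j k → X j k ℝ.≈ permMatrix (RawRing.rawSemiring ℝ.rawRing) (σ i) j k)

    Exact : Set
    Exact = conv permMatrices ≐ TH₁ (vanishingIdeal permMatrices)

    -- π : ℂ[x_σ] → ℂ[t_jk]; the variable t_jk has index combine j k.
    toricMap : ℂ[X].Poly d → ℂ[X].Poly (n ℕ.* n)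
    toricMap = ℂ[X].evaluate rawSemiring ℂ[X].constant
      (λ i → product (λ j → product (λ k →
        ℂ[X].var (combine j k) ^ permMatrix ℕ.+-*-rawSemiring (σ i) j k)))
      where
      open RawRing (ℂ[X].polyRing (n ℕ.* n)) using (rawSemiring)
      open SemiringOps rawSemiring using (product; _^_)

    toricIdeal : Pred (ℂ[X].Poly d) 0ℓ
    toricIdeal f = toricMap f ≈ 0#
      where open RawRing (ℂ[X].polyRing (n ℕ.* n)) using (_≈_; 0#)

{-# OPTIONS --safe #-}

-- By Farkas' lemma a matrix outside conv(A) is separated from A by an affine
-- form ℓ ≥ 0 on A.  Tilting ℓ towards integral forms vanishing on its zero set
-- F enlarges F, until any two points v, w ∉ F satisfy an integral relation
-- k·w + r = v + c with r, c supported on F and v.  If every such relation lets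
-- v be split off from w + r itself, then ℓ(v) ≤ ℓ(w), and by symmetry ℓ takes
-- only two values on A; scaled to 0 and 1 it is idempotent modulo I, hence
-- 1-sos, so the matrix is not in TH₁ either.
--
-- Splitting off v is permutation summability translated by v⁻¹.  It also
-- follows from quadratic Gröbner bases: take v as the last variable of the
-- reverse lexicographic order and reduce the monomial u = x^(w+r).  While v
-- does not divide u, the relation makes a power of u reducible; the leading
-- monomial of the reducing quadric is squarefree, so it already divides u.

module Submission where

open import Defs
open import Algebra.Bundles using (CommutativeRing; RawRing; Semiring)
import Algebra.Definitions.RawSemiring as SemiringOps
import Algebra.Properties.AbelianGroup as AbelianGroupProperties
import Algebra.Properties.CommutativeMonoid.Sum as CommutativeMonoidSum
import Algebra.Properties.Monoid.Mult as MonoidMult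
import Algebra.Properties.Ring as RingProperties
import Algebra.Properties.Semiring.Mult as SemiringMult
import Algebra.Properties.Semiring.Sum as SemiringSum
import Algebra.Solver.Ring as RingSolver
open import Algebra.Solver.Ring.AlmostCommutativeRing using (fromCommutativeRing; _-Raw-AlmostCommutative⟶_)
open import Data.Bool.Base using (Bool; true; false; if_then_else_)
open import Data.Fin.Base as Fin using (Fin; zero; suc; combine; fromℕ; remQuot)
open import Data.Fin.Permutation as Perm using (Permutation′; _⟨$⟩ʳ_; _⟨$⟩ˡ_)
import Data.Fin.Properties as Fin
open import Data.Fin.Subset using (Subset; _⊂_) renaming (_∈_ to _∈ˢ_)
open import Data.Fin.Subset.Induction using (⊂-wellFounded)
open import Data.Integer.Base as ℤ using (ℤ; +_; -[1+_]; _⊖_)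
import Data.Integer.Properties as ℤ
open import Data.List.Base as List using ([]; _∷_; _++_; length; filter; map; foldr)
open import Data.List.Membership.Propositional using (_∈_)
import Data.List.Properties as List
import Data.Maybe.Base as Maybe
open import Data.Nat.Base as ℕ using (ℕ; zero; suc; z≤n; s≤s)
open import Data.Nat.Induction using (<-wellFounded)
import Data.Nat.Properties as ℕ
open import Data.Product.Base using (Σ-syntax; ∃; ∃-syntax; _×_; _,_; proj₁; proj₂; uncurry)
open import Data.Sum.Base using (_⊎_; inj₁; inj₂; [_,_]′)
open import Data.Vec.Base as Vec using (lookup; zipWith; replicate; tabulate; _[_]≔_; []; _∷_)
open import Data.Vec.Functional as Vector using (Vector)
import Data.Vec.Properties as Vec
open import Function.Base using (_∘_; case_of_)
open import Function.Bundles using (mk⇔)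
open import Induction.WellFounded using (Acc; acc)
open import Level using (0ℓ)
open import Relation.Binary.Consequences using (dec⇒weaklyDec)
open import Relation.Binary.Core using (Rel)
open import Relation.Binary.Definitions using (Decidable; Total)
open import Relation.Binary.PropositionalEquality.Core as ≡ using (_≡_; _≢_)
open import Relation.Binary.PropositionalEquality.Properties using (module ≡-Reasoning)
open import Relation.Binary.Structures using (IsDecTotalOrder)
open import Relation.Nullary using (¬_; Dec; yes; no; does; contradiction; _×-dec_)
open import Relation.Nullary.Decidable using (decidable-stable; dec-false; dec-true; does-⇔; ¬?)
import Relation.Unary as Unary

-- Ordered domains and Farkas' lemma

-- Splitting off a permutation is a statement about multisets, so the relations between points must
-- be integral, whereas the separating form ℓ has arbitrary real values. Farkas' lemma is therefore
-- applied over two rings: over ℝ to separate the matrix, and over ℤ, where the 0/1 points live, to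
-- obtain either a relation or an integral functional. Hence it is proved without division, and that
-- is where the factor k comes from: over ℤ only a positive multiple of w is known to lie in a cone.
--
-- Removing this factor is the obstacle for both hypotheses: v visibly takes part in a multiple of w
-- + r, but it has to be split off from w + r itself. For summability it suffices that a positive
-- integer is at least 1; for Gröbner bases, squarefree leading monomials do it.
--
-- Were ℓ facet-defining, its zero set would span a hyperplane of the span of the points and the
-- relations would hold automatically. Tilting only until they hold avoids any theory of faces. The
-- functional m has opposite tendencies at v and w, so one of m and -m is always a safe direction at
-- the matrix.

module IntegerCoefficients (R : CommutativeRing 0ℓ 0ℓ) where
  open CommutativeRing R
  open SemiringMult semiring using (×-homo-+; ×1-homo-*) renaming (_×_ to _•_)
  open RingProperties ring using (-‿distribˡ-*; -‿distribʳ-*; -0#≈0#; -‿involutive)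
  open AbelianGroupProperties +-abelianGroup using (⁻¹-∙-comm)
  open import Relation.Binary.Reasoning.Setoid setoid

  nat : ℕ → Carrier
  nat n = n • 1#

  -- The canonical homomorphism from ℤ has two uses: it supplies the constants of the ring solver,
  -- and it carries integral relations and functionals into an ordered domain.
  int : ℤ → Carrier
  int (+ n)    = nat n
  int -[1+ n ] = - nat (suc n)

  private
    int-⊖ : ∀ m n → int (m ⊖ n) ≈ nat m - nat n
    int-⊖ m zero = sym (trans (+-congˡ -0#≈0#) (+-identityʳ _))
    int-⊖ zero (suc n) = sym (+-identityˡ _)
    int-⊖ (suc m) (suc n) = begin
      int (suc m ⊖ suc n)          ≡⟨ ≡.cong int (ℤ.[1+m]⊖[1+n]≡m⊖n m n) ⟩
      int (m ⊖ n)                  ≈⟨ int-⊖ m n ⟩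
      nat m - nat n                ≈⟨ +-congʳ (+-identityʳ _) ⟨
      nat m + 0# - nat n           ≈⟨ +-congʳ (+-congˡ (-‿inverseʳ 1#)) ⟨
      nat m + (1# - 1#) - nat n    ≈⟨ +-congʳ (+-assoc _ _ _) ⟨
      nat m + 1# - 1# - nat n      ≈⟨ +-assoc _ _ _ ⟩
      nat m + 1# + (- 1# - nat n)  ≈⟨ +-cong (+-comm _ _) (⁻¹-∙-comm _ _) ⟩
      nat (suc m) - nat (suc n)    ∎

    int-+ : ∀ i j → int (i ℤ.+ j) ≈ int i + int j
    int-+ (+ m)    (+ n)    = ×-homo-+ 1# m n
    int-+ (+ m)    -[1+ n ] = int-⊖ m (suc n)
    int-+ -[1+ m ] (+ n)    = trans (int-⊖ n (suc m)) (+-comm _ _)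
    int-+ -[1+ m ] -[1+ n ] = begin
      - nat (suc (suc (m ℕ.+ n)))      ≡⟨ ≡.cong (-_ ∘ nat ∘ suc) (≡.sym (ℕ.+-suc m n)) ⟩
      - nat (suc m ℕ.+ suc n)          ≈⟨ -‿cong (×-homo-+ 1# (suc m) (suc n)) ⟩
      - (nat (suc m) + nat (suc n))    ≈⟨ ⁻¹-∙-comm _ _ ⟨
      - nat (suc m) - nat (suc n)      ∎

    int-neg : ∀ i → int (ℤ.- i) ≈ - int i
    int-neg (+ zero)  = sym -0#≈0#
    int-neg (+ suc n) = refl
    int-neg -[1+ n ]  = sym (-‿involutive _)

    int-* : ∀ i j → int (i ℤ.* j) ≈ int i * int j
    int-* (+ m) (+ n) = trans (reflexive (≡.cong int (≡.sym (ℤ.pos-* m n)))) (×1-homo-* m n)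
    int-* (+ m) -[1+ n ] = begin
      int (+ m ℤ.* -[1+ n ])          ≡⟨ ≡.cong int (≡.sym (ℤ.neg-distribʳ-* (+ m) (+ suc n))) ⟩
      int (ℤ.- (+ m ℤ.* + suc n))     ≈⟨ int-neg (+ m ℤ.* + suc n) ⟩
      - int (+ m ℤ.* + suc n)         ≈⟨ -‿cong (int-* (+ m) (+ suc n)) ⟩
      - (nat m * nat (suc n))         ≈⟨ -‿distribʳ-* _ _ ⟩
      nat m * - nat (suc n)           ∎
    int-* -[1+ m ] j = begin
      int (-[1+ m ] ℤ.* j)            ≡⟨ ≡.cong int (≡.sym (ℤ.neg-distribˡ-* (+ suc m) j)) ⟩
      int (ℤ.- (+ suc m ℤ.* j))       ≈⟨ int-neg (+ suc m ℤ.* j) ⟩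
      - int (+ suc m ℤ.* j)           ≈⟨ -‿cong (lemma j) ⟩
      - (nat (suc m) * int j)         ≈⟨ -‿distribˡ-* _ _ ⟩
      - nat (suc m) * int j           ∎
      where
      lemma : ∀ j → int (+ suc m ℤ.* j) ≈ nat (suc m) * int j
      lemma (+ n) = trans (reflexive (≡.cong int (≡.sym (ℤ.pos-* (suc m) n)))) (×1-homo-* (suc m) n)
      lemma -[1+ n ] = begin
        int (+ suc m ℤ.* -[1+ n ])          ≡⟨ ≡.cong int (≡.sym (ℤ.neg-distribʳ-* (+ suc m) (+ suc n))) ⟩
        int (ℤ.- (+ suc m ℤ.* + suc n))     ≈⟨ int-neg (+ suc m ℤ.* + suc n) ⟩
        - int (+ suc m ℤ.* + suc n)         ≈⟨ -‿cong (lemma (+ suc n)) ⟩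
        - (nat (suc m) * nat (suc n))       ≈⟨ -‿distribʳ-* _ _ ⟩
        nat (suc m) * - nat (suc n)         ∎

  homomorphism : CommutativeRing.rawRing ℤ.+-*-commutativeRing -Raw-AlmostCommutative⟶ fromCommutativeRing R
  homomorphism = record
    { ⟦_⟧    = int
    ; +-homo = int-+
    ; *-homo = int-*
    ; -‿homo = int-neg
    ; 0-homo = refl
    ; 1-homo = +-identityʳ 1#
    }

  open _-Raw-AlmostCommutative⟶_ homomorphism public using (+-homo; *-homo; -‿homo; 1-homo)

  module Solver = RingSolver _ (fromCommutativeRing R) homomorphism
    (λ i j → Maybe.map (λ i≡j → reflexive (≡.cong int i≡j)) (dec⇒weaklyDec ℤ._≟_ i j))

-- ℤ and ℝ are the intended instances. Positivity of products takes the place of division: it lets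
-- positive factors be cancelled from inequalities.
record OrderedDomain : Set₁ where
  infix 4 _≤_ _<_
  field
    commutativeRing : CommutativeRing 0ℓ 0ℓ

  open CommutativeRing commutativeRing public hiding (_≉_; zero)

  field
    _≤_             : Rel Carrier 0ℓ
    isDecTotalOrder : IsDecTotalOrder _≈_ _≤_

  _<_ : Rel Carrier 0ℓ
  x < y = ¬ y ≤ x

  field
    +-monoˡ-≤  : ∀ z {x y} → x ≤ y → x + z ≤ y + z
    *-positive : ∀ {x y} → 0# < x → 0# < y → 0# < x * y
    0<1        : 0# < 1#

  open IsDecTotalOrder isDecTotalOrder public
    using (_≟_; _≤?_; total; antisym)
    renaming (refl to ≤-refl; reflexive to ≤-reflexive; trans to ≤-trans; ≤-resp-≈ to ≤-resp-≈)

module OrderedDomainProperties (O : OrderedDomain) where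
  open OrderedDomain O
  open IntegerCoefficients commutativeRing public using (module Solver)
  open Solver
  open SemiringSum semiring using (sum; sum-cong-≋; *-distribˡ-sum; ∑-distrib-+; ∑-comm; sum-replicate-zero)

  ≤-respˡ : ∀ {x y z} → x ≈ y → x ≤ z → y ≤ z
  ≤-respˡ = proj₂ ≤-resp-≈

  ≤-respʳ : ∀ {x y z} → x ≈ y → z ≤ x → z ≤ y
  ≤-respʳ = proj₁ ≤-resp-≈

  <-respʳ : ∀ {x y z} → x ≈ y → z < x → z < y
  <-respʳ x≈y z<x y≤z = z<x (≤-respˡ (sym x≈y) y≤z)

  <-respˡ : ∀ {x y z} → x ≈ y → x < z → y < z
  <-respˡ x≈y x<z z≤y = x<z (≤-respʳ (sym x≈y) z≤y)

  <⇒≤ : ∀ {x y} → x < y → x ≤ y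
  <⇒≤ {x} {y} x<y = [ (λ x≤y → x≤y) , (λ y≤x → contradiction y≤x x<y) ]′ (total x y)

  ≮⇒≥ : ∀ {x y} → ¬ x < y → y ≤ x
  ≮⇒≥ {x} {y} = decidable-stable (y ≤? x)

  ≤-<-trans : ∀ {x y z} → x ≤ y → y < z → x < z
  ≤-<-trans x≤y y<z z≤x = y<z (≤-trans z≤x x≤y)

  <-≤-trans : ∀ {x y z} → x < y → y ≤ z → x < z
  <-≤-trans x<y y≤z z≤x = x<y (≤-trans y≤z z≤x)

  <⇒≉ : ∀ {x y} → x < y → ¬ x ≈ y
  <⇒≉ x<y x≈y = x<y (≤-reflexive (sym x≈y))

  ≤∧≉⇒< : ∀ {x y} → x ≤ y → ¬ x ≈ y → x < y
  ≤∧≉⇒< x≤y x≉y y≤x = x≉y (antisym x≤y y≤x)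

  x≤y⇒0≤y-x : ∀ {x y} → x ≤ y → 0# ≤ y - x
  x≤y⇒0≤y-x {x} x≤y = ≤-respˡ (-‿inverseʳ x) (+-monoˡ-≤ (- x) x≤y)

  0≤y-x⇒x≤y : ∀ {x y} → 0# ≤ y - x → x ≤ y
  0≤y-x⇒x≤y {x} {y} 0≤y-x = ≤-respˡ (+-identityˡ x)
    (≤-respʳ (solve 2 (λ x y → y :- x :+ x := y) refl x y) (+-monoˡ-≤ x 0≤y-x))

  x<y⇒0<y-x : ∀ {x y} → x < y → 0# < y - x
  x<y⇒0<y-x {x} {y} x<y y-x≤0 = x<y (≤-respˡ (solve 2 (λ x y → y :- x :+ x := y) refl x y)
    (≤-respʳ (+-identityˡ x) (+-monoˡ-≤ x y-x≤0)))

  x<0⇒0<-x : ∀ {x} → x < 0# → 0# < - x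
  x<0⇒0<-x = <-respʳ (+-identityˡ _) ∘ x<y⇒0<y-x

  x≤0⇒0≤-x : ∀ {x} → x ≤ 0# → 0# ≤ - x
  x≤0⇒0≤-x = ≤-respʳ (+-identityˡ _) ∘ x≤y⇒0≤y-x

  0≤x⇒-x≤0 : ∀ {x} → 0# ≤ x → - x ≤ 0#
  0≤x⇒-x≤0 {x} 0≤x = ≤-respˡ (+-identityˡ (- x)) (≤-respʳ (-‿inverseʳ x) (+-monoˡ-≤ (- x) 0≤x))

  +-monoʳ-≤ : ∀ z {x y} → x ≤ y → z + x ≤ z + y
  +-monoʳ-≤ z {x} {y} x≤y = ≤-respˡ (+-comm x z) (≤-respʳ (+-comm y z) (+-monoˡ-≤ z x≤y))

  +-nonneg : ∀ {x y} → 0# ≤ x → 0# ≤ y → 0# ≤ x + y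
  +-nonneg {x} {y} 0≤x 0≤y = ≤-trans 0≤y (≤-respˡ (+-identityˡ y) (+-monoˡ-≤ y 0≤x))

  +-pos-nonneg : ∀ {x y} → 0# < x → 0# ≤ y → 0# < x + y
  +-pos-nonneg {x} {y} 0<x 0≤y = <-≤-trans 0<x
    (≤-respˡ (+-identityˡ x) (≤-respʳ (+-comm y x) (+-monoˡ-≤ x 0≤y)))

  +-nonneg-pos : ∀ {x y} → 0# ≤ x → 0# < y → 0# < x + y
  +-nonneg-pos 0≤x 0<y = <-respʳ (+-comm _ _) (+-pos-nonneg 0<y 0≤x)

  *-nonneg : ∀ {x y} → 0# ≤ x → 0# ≤ y → 0# ≤ x * y
  *-nonneg {x} {y} 0≤x 0≤y with x ≤? 0# | y ≤? 0#
  ... | yes x≤0 | _       = ≤-reflexive (sym (trans (*-congʳ (antisym x≤0 0≤x)) (zeroˡ y)))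
  ... | no _    | yes y≤0 = ≤-reflexive (sym (trans (*-congˡ (antisym y≤0 0≤y)) (zeroʳ x)))
  ... | no 0<x  | no 0<y  = <⇒≤ (*-positive 0<x 0<y)

  *-cancelˡ-nonneg : ∀ {x y} → 0# < x → 0# ≤ x * y → 0# ≤ y
  *-cancelˡ-nonneg {x} {y} 0<x 0≤xy = decidable-stable (0# ≤? y) λ y<0 →
    *-positive 0<x (x<0⇒0<-x y<0)
      (≤-respˡ (solve 2 (λ x y → :- (x :* y) := x :* :- y) refl x y)
        (≤-respʳ (-‿inverseʳ (x * y)) (≤-respˡ (+-identityˡ _) (+-monoˡ-≤ (- (x * y)) 0≤xy))))

  square-positive : ∀ {x} → ¬ x ≈ 0# → 0# < x * x
  square-positive {x} x≉0 with x ≤? 0#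
  ... | no 0<x  = *-positive 0<x 0<x
  ... | yes x≤0 = <-respʳ (solve 1 (λ x → :- x :* :- x := x :* x) refl x) (*-positive 0<-x 0<-x)
    where 0<-x = x<0⇒0<-x (≤∧≉⇒< x≤0 x≉0)

  square-nonneg : ∀ x → 0# ≤ x * x
  square-nonneg x with x ≟ 0#
  ... | yes x≈0 = ≤-reflexive (sym (trans (*-congʳ x≈0) (zeroˡ x)))
  ... | no x≉0  = <⇒≤ (square-positive x≉0)

  sum-nonneg : ∀ {n} (f : Vector Carrier n) → (∀ i → 0# ≤ f i) → 0# ≤ sum f
  sum-nonneg {zero}  f f≥0 = ≤-refl
  sum-nonneg {suc n} f f≥0 = +-nonneg (f≥0 zero) (sum-nonneg (f ∘ suc) (f≥0 ∘ suc))

  sum-positive : ∀ {n} (f : Vector Carrier n) → (∀ i → 0# ≤ f i) → ∀ i → 0# < f i → 0# < sum f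
  sum-positive f f≥0 zero    0<fi = +-pos-nonneg 0<fi (sum-nonneg (f ∘ suc) (f≥0 ∘ suc))
  sum-positive f f≥0 (suc i) 0<fi = +-nonneg-pos (f≥0 zero) (sum-positive (f ∘ suc) (f≥0 ∘ suc) i 0<fi)

  term≤sum : ∀ {n} (f : Vector Carrier n) → (∀ i → 0# ≤ f i) → ∀ i → f i ≤ sum f
  term≤sum f f≥0 zero    = ≤-respˡ (+-identityʳ _) (+-monoʳ-≤ (f zero) (sum-nonneg (f ∘ suc) (f≥0 ∘ suc)))
  term≤sum f f≥0 (suc i) = ≤-trans (term≤sum (f ∘ suc) (f≥0 ∘ suc) i)
    (≤-respˡ (+-identityˡ _) (+-monoˡ-≤ (sum (f ∘ suc)) (f≥0 zero)))

  infix 8 _·_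
  _·_ : ∀ {N} → Vector Carrier N → Vector Carrier N → Carrier
  y · a = sum λ j → y j * a j

  ·-congʳ : ∀ {N} (y : Vector Carrier N) {a b : Vector Carrier N} → (∀ j → a j ≈ b j) → y · a ≈ y · b
  ·-congʳ y a≈b = sum-cong-≋ λ j → *-congˡ (a≈b j)

  ·-linearˡ : ∀ {N} α (y : Vector Carrier N) β (z a : Vector Carrier N) →
              (λ j → α * y j + β * z j) · a ≈ α * y · a + β * z · a
  ·-linearˡ {N} α y β z a = trans
    (sum-cong-≋ λ j → solve 5 (λ α y β z a → (α :* y :+ β :* z) :* a := α :* (y :* a) :+ β :* (z :* a))
      refl α (y j) β (z j) (a j))
    (trans (∑-distrib-+ {N} _ _) (+-cong (sym (*-distribˡ-sum {N} α _)) (sym (*-distribˡ-sum {N} β _))))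

  ·-linearʳ : ∀ {N} (y : Vector Carrier N) α (a : Vector Carrier N) β (b : Vector Carrier N) →
              y · (λ j → α * a j + β * b j) ≈ α * y · a + β * y · b
  ·-linearʳ {N} y α a β b = trans
    (sum-cong-≋ λ j → solve 5 (λ y α a β b → y :* (α :* a :+ β :* b) := α :* (y :* a) :+ β :* (y :* b))
      refl (y j) α (a j) β (b j))
    (trans (∑-distrib-+ {N} _ _) (+-cong (sym (*-distribˡ-sum {N} α _)) (sym (*-distribˡ-sum {N} β _))))

  ·-sum : ∀ {N d} (y : Vector Carrier N) (c : Vector Carrier d) (a : Fin d → Vector Carrier N) →
          y · (λ j → sum λ i → c i * a i j) ≈ sum (λ i → c i * y · a i)
  ·-sum {N} {d} y c a = trans
    (sum-cong-≋ λ j → trans (*-distribˡ-sum {d} (y j) _)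
      (sum-cong-≋ λ i → solve 3 (λ y c a → y :* (c :* a) := c :* (y :* a)) refl (y j) (c i) (a i j)))
    (trans (∑-comm {N} {d} _) (sum-cong-≋ λ i → sym (*-distribˡ-sum {N} (c i) _)))

  -- Since no division is available, membership in the cone is only asserted
  -- for a positive multiple of b.
  InCone : ∀ {d N} → (Fin d → Vector Carrier N) → Vector Carrier N → Set
  InCone {d} a b = ∃[ k ] Σ[ c ∈ Vector Carrier d ] 0# < k × (∀ i → 0# ≤ c i) ×
    (∀ j → k * b j ≈ sum λ i → c i * a i j)

  Separated : ∀ {d N} → (Fin d → Vector Carrier N) → Vector Carrier N → Set
  Separated {N = N} a b = Σ[ y ∈ Vector Carrier N ] (∀ i → 0# ≤ y · a i) × y · b < 0#

  -- If y separates a₁,…,a_d but not a₀ from b, then recurse on the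
  -- projections of all vectors along a₀ to the hyperplane y = 0.
  farkas : ∀ {d N} (a : Fin d → Vector Carrier N) b → InCone a b ⊎ Separated a b
  farkas {zero} {N} a b with Fin.any? (λ j → ¬? (b j ≟ 0#))
  ... | no b≈0 = inj₁ (1# , (λ ()) , 0<1 , (λ ()) , λ j →
    trans (*-identityˡ _) (decidable-stable (b j ≟ 0#) λ bj≉0 → b≈0 (j , bj≉0)))
  -- With no generators the cone is the origin, and -b separates a nonzero b from it because b · b
  -- is positive.
  ... | yes (j , bj≉0) = inj₂ ((λ j → - b j) , (λ ()) , λ 0≤-b·b →
    +-nonneg-pos 0≤-b·b
      (sum-positive _ (λ j → square-nonneg (b j)) j (square-positive bj≉0))
      (≤-reflexive -b·b+b·b≈0))
    where
    -b·b+b·b≈0 : (λ j → - b j) · b + b · b ≈ 0#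
    -b·b+b·b≈0 = trans (sym (∑-distrib-+ (λ j → - b j * b j) (λ j → b j * b j)))
      (trans (sum-cong-≋ λ j → solve 1 (λ x → :- x :* x :+ x :* x := con (+ 0)) refl (b j))
        (sum-replicate-zero N))
  farkas {suc d} {N} a b with farkas (a ∘ suc) b
  ... | inj₁ (k , c , 0<k , c≥0 , kb≈) =
    inj₁ (k , (λ { zero → 0# ; (suc i) → c i }) , 0<k , (λ { zero → ≤-refl ; (suc i) → c≥0 i }) ,
      λ j → trans (kb≈ j) (sym (trans (+-congʳ (zeroˡ _)) (+-identityˡ _))))
  ... | inj₂ (y , ya≥0 , yb<0) with 0# ≤? y · a zero
  ... | yes ya₀≥0 = inj₂ (y , (λ { zero → ya₀≥0 ; (suc i) → ya≥0 i }) , yb<0)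
  ... | no ya₀<0 = go (farkas (λ i j → α * a (suc i) j + y · a (suc i) * a zero j)
                              (λ j → α * b j + y · b * a zero j))
    where
    α = - (y · a zero)
    0<α = x<0⇒0<-x ya₀<0

    go : InCone _ _ ⊎ Separated _ _ → InCone a b ⊎ Separated a b
    go (inj₁ (k , c , 0<k , c≥0 , kb′≈)) = inj₁ (k * α , c′ , *-positive 0<k 0<α , c′≥0 , eq)
      where
      -- Undoing the projection collects all multiples of a₀ in one coefficient. It is nonnegative
      -- because y is negative at b and nonnegative at the other generators.
      c′ : Vector Carrier (suc d)
      c′ zero    = k * - (y · b) + sum (λ i → c i * y · a (suc i))
      c′ (suc i) = α * c i
      c′≥0 : ∀ i → 0# ≤ c′ i
      c′≥0 zero    = +-nonneg (*-nonneg (<⇒≤ 0<k) (<⇒≤ (x<0⇒0<-x yb<0)))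
                       (sum-nonneg _ λ i → *-nonneg (c≥0 i) (ya≥0 i))
      c′≥0 (suc i) = *-nonneg (<⇒≤ 0<α) (c≥0 i)
      module _ (j : Fin N) where
        S₁ = sum (λ i → c i * y · a (suc i))
        S₂ = sum (λ i → c i * a (suc i) j)
        expand : sum (λ i → c i * (α * a (suc i) j + y · a (suc i) * a zero j)) ≈ α * S₂ + a zero j * S₁
        expand = trans
          (sum-cong-≋ λ i → solve 5 (λ c α x y z → c :* (α :* x :+ y :* z) := α :* (c :* x) :+ z :* (c :* y))
            refl (c i) α (a (suc i) j) (y · a (suc i)) (a zero j))
          (trans (∑-distrib-+ {d} _ _) (+-cong (sym (*-distribˡ-sum {d} α _)) (sym (*-distribˡ-sum {d} (a zero j) _))))
        collect : sum (λ i → α * c i * a (suc i) j) ≈ α * S₂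
        collect = trans (sum-cong-≋ λ i → *-assoc α (c i) (a (suc i) j)) (sym (*-distribˡ-sum {d} α _))
        eq : k * α * b j ≈ sum (λ i → c′ i * a i j)
        eq = trans
          (solve 5 (λ k α β x z → k :* α :* x := k :* (α :* x :+ β :* z) :- k :* β :* z) refl k α (y · b) (b j) (a zero j))
          (trans (+-congʳ (trans (kb′≈ j) expand))
          (trans (solve 5 (λ S₂′ S₁ k β z → S₂′ :+ z :* S₁ :- k :* β :* z := (k :* :- β :+ S₁) :* z :+ S₂′)
            refl (α * S₂) S₁ k (y · b) (a zero j))
            (+-congˡ (sym collect))))
    go (inj₂ (z , za′≥0 , zb′<0)) = inj₂ (y″ , y″a≥0 , λ 0≤ → zb′<0 (≤-respʳ (y″-eq b) 0≤))
      where
      -- This is z composed with the projection, so it vanishes at a₀, which the projection kills.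
      y″ = λ j → α * z j + z · a zero * y j
      y″-eq : ∀ x → y″ · x ≈ z · (λ j → α * x j + y · x * a zero j)
      y″-eq x = trans (·-linearˡ α z (z · a zero) y x)
        (trans (+-congˡ (*-comm _ _)) (sym (·-linearʳ z α x (y · x) (a zero))))
      y″a≥0 : ∀ i → 0# ≤ y″ · a i
      y″a≥0 zero    = ≤-reflexive (sym (trans (·-linearˡ α z (z · a zero) y (a zero))
        (solve 2 (λ x y → :- x :* y :+ y :* x := con (+ 0)) refl (y · a zero) (z · a zero))))
      y″a≥0 (suc i) = ≤-respʳ (sym (y″-eq (a (suc i)))) (za′≥0 i)

-- Integral relations between 0/1 points

-- Transitivity is demanded only through a middle element satisfying P: ratios compared by
-- cross-multiplication are transitive only through a positive denominator.
argmin : ∀ {d} {P : Unary.Pred (Fin d) 0ℓ} {_≲_ : Rel (Fin d) 0ℓ} → Unary.Decidable P → Total _≲_ →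
         (∀ {i j k} → P j → i ≲ j → j ≲ k → i ≲ k) →
         ∃ P → Σ[ i ∈ Fin d ] P i × (∀ j → P j → i ≲ j)
argmin {suc d} {P} {_≲_} P? tot tr (w , Pw) with Fin.any? (P? ∘ suc)
... | no ¬Psuc = zero , P0 w Pw , only
  where
  P0 : ∀ w → P w → P zero
  P0 zero    P0 = P0
  P0 (suc w) Pw = contradiction (w , Pw) ¬Psuc
  only : ∀ j → P j → zero ≲ j
  only zero    _  = [ (λ z → z) , (λ z → z) ]′ (tot zero zero)
  only (suc j) Pj = contradiction (j , Pj) ¬Psuc
... | yes ∃P with argmin (P? ∘ suc) (λ i j → tot (suc i) (suc j)) tr ∃P | P? zero
...   | i , Pi , i≲ | no ¬P0 = suc i , Pi , λ { zero P0 → contradiction P0 ¬P0 ; (suc j) → i≲ j }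
...   | i , Pi , i≲ | yes P0 with tot zero (suc i)
...     | inj₁ 0≲i = zero , P0 , λ { zero _ → [ (λ z → z) , (λ z → z) ]′ (tot zero zero)
                                   ; (suc j) Pj → tr Pi 0≲i (i≲ j Pj) }
...     | inj₂ i≲0 = suc i , Pi , λ { zero _ → i≲0 ; (suc j) → i≲ j }

module SemiringIndicators (S : Semiring 0ℓ 0ℓ) where
  open Semiring S hiding (zero)
  open SemiringSum S using (sum; sum-cong-≋; sum-replicate-zero)

  bit : Bool → Carrier
  bit b = if b then 1# else 0#

  sum-indicator : ∀ {d} (w : Fin d) (g : Vector Carrier d) →
                  sum (λ i → bit (does (i Fin.≟ w)) * g i) ≈ g w
  sum-indicator {suc d} zero g = trans
    (+-cong (*-identityˡ _) (trans (sum-cong-≋ λ i → zeroˡ (g (suc i))) (sum-replicate-zero d)))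
    (+-identityʳ _)
  sum-indicator {suc d} (suc w) g = trans (+-cong (zeroˡ _) (sum-indicator w (g ∘ suc))) (+-identityˡ _)

module Indicators (R : CommutativeRing 0ℓ 0ℓ) where
  open CommutativeRing R hiding (zero)
  open IntegerCoefficients R
  open SemiringSum semiring using (sum)
  open SemiringIndicators semiring public

  int-bit : ∀ b → int (if b then ℤ.1ℤ else ℤ.0ℤ) ≈ bit b
  int-bit true  = 1-homo
  int-bit false = refl

  int-sum : ∀ {d} (f : Vector ℤ d) →
            int (SemiringSum.sum (CommutativeRing.semiring ℤ.+-*-commutativeRing) f) ≈ sum (int ∘ f)
  int-sum {zero}  f = refl
  int-sum {suc d} f = trans (+-homo (f zero) _) (+-congˡ (int-sum (f ∘ suc)))

integerDomain : OrderedDomain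
integerDomain = record
  { commutativeRing = ℤ.+-*-commutativeRing
  ; isDecTotalOrder = ℤ.≤-isDecTotalOrder
  ; +-monoˡ-≤       = λ z → ℤ.+-monoˡ-≤ z
  ; *-positive      = positive
  ; 0<1             = λ { (ℤ.+≤+ ()) }
  }
  where
  positive : ∀ {x y} → ¬ x ℤ.≤ ℤ.0ℤ → ¬ y ℤ.≤ ℤ.0ℤ → ¬ (x ℤ.* y) ℤ.≤ ℤ.0ℤ
  positive {+ zero}    {y}         0<x _ = contradiction ℤ.≤-refl 0<x
  positive { -[1+ _ ]} {y}         0<x _ = contradiction ℤ.-≤+ 0<x
  positive {+ suc m}   {+ zero}    _ 0<y = contradiction ℤ.≤-refl 0<y
  positive {+ suc m}   { -[1+ _ ]} _ 0<y = contradiction ℤ.-≤+ 0<y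
  positive {+ suc m}   {+ suc n}   _ _   (ℤ.+≤+ ())

private
  module Z = OrderedDomainProperties integerDomain
open SemiringSum (CommutativeRing.semiring ℤ.+-*-commutativeRing) using () renaming
  ( sum to sumℤ; sum-cong-≋ to sumℤ-cong; sum-replicate-zero to sumℤ-zero; ∑-comm to sumℤ-comm
  ; ∑-distrib-+ to sumℤ-+; *-distribˡ-sum to *-distribˡ-sumℤ )
open Indicators ℤ.+-*-commutativeRing using () renaming (bit to bitℤ; sum-indicator to sumℤ-indicator)

+bit : ∀ b → + (if b then 1 else 0) ≡ bitℤ b
+bit true  = ≡.refl
+bit false = ≡.refl

module Points {d N : ℕ} (p : Fin d → Fin N → Bool) where
  open Z.Solver

  pointℤ : Fin d → Vector ℤ N
  pointℤ i x = bitℤ (p i x)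

  infix 4 _~_
  _~_ : Rel (Fin d → ℕ) 0ℓ
  a ~ b = ∀ x → sumℤ (λ i → + a i ℤ.* pointℤ i x) ≡ sumℤ (λ i → + b i ℤ.* pointℤ i x)

  -- For permutations, w ≢ v ensures that there is a column, whose sum recovers
  -- the degree from the matrix entries.
  Exchange : Set
  Exchange = ∀ {v w} → w ≢ v → ∀ k (a b : Fin d → ℕ) → (λ i → suc k ℕ.* a i) ~ b → 0 ℕ.< b v →
             ∃[ u ] a ~ u × 0 ℕ.< u v

  δ : Fin d → Fin d → ℕ
  δ w i = if does (i Fin.≟ w) then 1 else 0

  module _ (F : Fin d → Bool) (v w : Fin d) where
    private
      f : Fin d → ℕ
      f i = if F i then 1 else 0

      restricted : Fin d → Vector ℤ N
      restricted i x = + f i ℤ.* pointℤ i x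

      -- Together with their negated sum the restricted points generate, as a
      -- cone, the linear span of the points in F.
      generators : Fin (2 ℕ.+ d) → Vector ℤ N
      generators zero          = λ x → ℤ.- ℤ.1ℤ ℤ.* sumℤ (λ i → ℤ.1ℤ ℤ.* restricted i x) ℤ.+ ℤ.0ℤ ℤ.* ℤ.0ℤ
      generators (suc zero)    = pointℤ v
      generators (suc (suc i)) = restricted i

    Relation : Set
    Relation = ∃[ k ] Σ[ a ∈ (Fin d → ℕ) ] Σ[ b ∈ (Fin d → ℕ) ] (λ i → suc k ℕ.* a i) ~ b ×
      (∀ i → F i ≡ false → a i ≡ δ w i) × (∀ i → F i ≡ false → i ≢ v → b i ≡ 0)

    Functional : Set
    Functional = Σ[ m ∈ Vector ℤ N ] (∀ i → F i ≡ true → m Z.· pointℤ i ≡ ℤ.0ℤ) ×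
      ℤ.0ℤ ℤ.≤ m Z.· pointℤ v × ¬ ℤ.0ℤ ℤ.≤ m Z.· pointℤ w

    -- Farkas' lemma over ℤ, asking whether a multiple of w lies in the cone of v plus the span of
    -- F.
    relation-or-functional : Relation ⊎ Functional
    relation-or-functional with Z.farkas generators (pointℤ w)
    ... | inj₁ (+ zero , _ , 0<0 , _) = contradiction ℤ.≤-refl 0<0
    ... | inj₁ (-[1+ _ ] , _ , 0<- , _) = contradiction ℤ.-≤+ 0<-
    ... | inj₁ (+ suc k , c , _ , c≥0 , eq) = inj₁ (k , a , b , ka~b , a-off , b-off)
      where
      γ : Fin (2 ℕ.+ d) → ℕ
      γ i = ℤ.∣ c i ∣
      -- Let K = `suc k` and let s be the sum of the points in F. The cone identity expresses K w
      -- through -s, v and the points of F. Adding K times `c zero` times s to both sides makes the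
      -- left side a K-fold multiple as a whole; the generator -s absorbs one of the K copies on the
      -- right, which leaves the factor k in `b`.
      a b : Fin d → ℕ
      a i = δ w i ℕ.+ γ zero ℕ.* f i
      b i = γ (suc zero) ℕ.* δ v i ℕ.+ (γ (suc (suc i)) ℕ.* f i ℕ.+ k ℕ.* (γ zero ℕ.* f i))
      a-off : ∀ i → F i ≡ false → a i ≡ δ w i
      a-off i Fi≡f rewrite Fi≡f | ℕ.*-zeroʳ (γ zero) = ℕ.+-identityʳ _
      b-off : ∀ i → F i ≡ false → i ≢ v → b i ≡ 0
      b-off i Fi≡f i≢v rewrite Fi≡f | dec-false (i Fin.≟ v) i≢v
        | ℕ.*-zeroʳ (γ zero) | ℕ.*-zeroʳ (γ (suc zero)) | ℕ.*-zeroʳ (γ (suc (suc i))) | ℕ.*-zeroʳ k = ≡.refl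
      γ≡c : ∀ i → + γ i ≡ c i
      γ≡c i = ℤ.0≤i⇒+∣i∣≡i (c≥0 i)
      +δ : ∀ w i → + δ w i ≡ bitℤ (does (i Fin.≟ w))
      +δ w i with does (i Fin.≟ w)
      ... | true  = ≡.refl
      ... | false = ≡.refl
      module _ (x : Fin N) where
        P = λ i → pointℤ i x
        δᵥ = λ i → bitℤ (does (i Fin.≟ v))
        δʷ = λ i → bitℤ (does (i Fin.≟ w))
        fℤ = λ i → + f i
        cf = λ i → c (suc (suc i)) ℤ.* + f i
        K = + suc k
        inner = λ i → ℤ.1ℤ ℤ.* cf i ℤ.+ (+ k ℤ.* c zero) ℤ.* fℤ i
        +a : ∀ i → + (suc k ℕ.* a i) ≡ K ℤ.* δʷ i ℤ.+ (K ℤ.* c zero) ℤ.* fℤ i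
        +a i = ≡.trans (ℤ.pos-* (suc k) (a i)) (≡.trans
          (≡.cong (K ℤ.*_) (≡.cong₂ ℤ._+_ (+δ w i)
            (≡.trans (ℤ.pos-* (γ zero) (f i)) (≡.cong (ℤ._* fℤ i) (γ≡c zero)))))
          (solve 4 (λ K d c f → K :* (d :+ c :* f) := K :* d :+ (K :* c) :* f) ≡.refl K (δʷ i) (c zero) (fℤ i)))
        +b : ∀ i → + b i ≡ c (suc zero) ℤ.* δᵥ i ℤ.+ ℤ.1ℤ ℤ.* (ℤ.1ℤ ℤ.* cf i ℤ.+ (+ k ℤ.* c zero) ℤ.* fℤ i)
        +b i = ≡.trans
          (≡.cong₂ ℤ._+_
            (≡.trans (ℤ.pos-* (γ (suc zero)) _) (≡.cong₂ ℤ._*_ (γ≡c (suc zero)) (+δ v i)))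
            (≡.cong₂ ℤ._+_
              (≡.trans (ℤ.pos-* (γ (suc (suc i))) _) (≡.cong (ℤ._* fℤ i) (γ≡c (suc (suc i)))))
              (≡.trans (ℤ.pos-* k _) (≡.cong (+ k ℤ.*_)
                (≡.trans (ℤ.pos-* (γ zero) (f i)) (≡.cong (ℤ._* fℤ i) (γ≡c zero)))))))
          (solve 5 (λ u c k c₀ f → u :+ (c :* f :+ k :* (c₀ :* f)) :=
              u :+ con ℤ.1ℤ :* (con ℤ.1ℤ :* (c :* f) :+ (k :* c₀) :* f))
            ≡.refl (c (suc zero) ℤ.* δᵥ i) (c (suc (suc i))) (+ k) (c zero) (fℤ i))
        lhs : sumℤ (λ i → + (suc k ℕ.* a i) ℤ.* P i) ≡ K ℤ.* P w ℤ.+ (K ℤ.* c zero) ℤ.* (fℤ Z.· P)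
        lhs = ≡.trans (sumℤ-cong λ i → ≡.cong (ℤ._* P i) (+a i))
          (≡.trans (Z.·-linearˡ K δʷ (K ℤ.* c zero) fℤ P)
            (≡.cong (λ z → K ℤ.* z ℤ.+ (K ℤ.* c zero) ℤ.* (fℤ Z.· P)) (sumℤ-indicator w P)))
        rhs : sumℤ (λ i → + b i ℤ.* P i) ≡
              c (suc zero) ℤ.* P v ℤ.+ (cf Z.· P ℤ.+ (+ k ℤ.* c zero) ℤ.* (fℤ Z.· P))
        rhs = ≡.trans (sumℤ-cong λ i → ≡.cong (ℤ._* P i) (+b i))
          (≡.trans (Z.·-linearˡ (c (suc zero)) δᵥ ℤ.1ℤ inner P)
            (≡.cong₂ ℤ._+_ (≡.cong (c (suc zero) ℤ.*_) (sumℤ-indicator v P))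
              (≡.trans (ℤ.*-identityˡ (inner Z.· P)) (≡.trans (Z.·-linearˡ ℤ.1ℤ cf (+ k ℤ.* c zero) fℤ P)
                (≡.cong (ℤ._+ (+ k ℤ.* c zero) ℤ.* (fℤ Z.· P)) (ℤ.*-identityˡ (cf Z.· P)))))))
        ka~b-at : sumℤ (λ i → + (suc k ℕ.* a i) ℤ.* P i) ≡ sumℤ (λ i → + b i ℤ.* P i)
        ka~b-at = ≡.trans lhs (≡.trans (≡.cong (ℤ._+ (K ℤ.* c zero) ℤ.* (fℤ Z.· P)) (≡.trans (eq x)
          (≡.cong₂ (λ s t → c zero ℤ.* (ℤ.- ℤ.1ℤ ℤ.* s ℤ.+ ℤ.0ℤ ℤ.* ℤ.0ℤ) ℤ.+ (c (suc zero) ℤ.* P v ℤ.+ t))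
            (sumℤ-cong {d} λ i → ℤ.*-identityˡ (restricted i x))
            (sumℤ-cong {d} λ i → ≡.sym (ℤ.*-assoc (c (suc (suc i))) (fℤ i) (P i))))))
          (≡.trans
            (solve 5 (λ c s u t k → c :* (:- con ℤ.1ℤ :* s :+ con ℤ.0ℤ :* con ℤ.0ℤ) :+ (u :+ t)
                :+ ((con ℤ.1ℤ :+ k) :* c) :* s := u :+ (t :+ (k :* c) :* s))
              ≡.refl (c zero) (fℤ Z.· P) (c (suc zero) ℤ.* P v) (cf Z.· P) (+ k))
            (≡.sym rhs)))
      ka~b : (λ i → suc k ℕ.* a i) ~ b
      ka~b = ka~b-at
    ... | inj₂ (m , mg≥0 , mw<0) = inj₂ (m , on-F , mg≥0 (suc zero) , mw<0)
      where
      S = sumℤ (λ i → ℤ.1ℤ ℤ.* m Z.· restricted i)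
      -- The first generator is spelled as a linear combination so that linearity rewrites the value
      -- of m at it as -S. As S is also a sum of nonnegative values, each of them must vanish.
      S≤0 : S ℤ.≤ ℤ.0ℤ
      S≤0 = ≡.subst₂ ℤ._≤_ (ℤ.+-identityˡ S)
        (≡.trans (≡.cong (ℤ._+ S) (≡.trans
            (Z.·-linearʳ m (ℤ.- ℤ.1ℤ) (λ x → sumℤ (λ i → ℤ.1ℤ ℤ.* restricted i x)) ℤ.0ℤ (λ _ → ℤ.0ℤ))
            (≡.cong (λ z → ℤ.- ℤ.1ℤ ℤ.* z ℤ.+ ℤ.0ℤ ℤ.* m Z.· (λ _ → ℤ.0ℤ)) (Z.·-sum m (λ _ → ℤ.1ℤ) restricted))))
          (solve 2 (λ s t → :- con ℤ.1ℤ :* s :+ con ℤ.0ℤ :* t :+ s := con ℤ.0ℤ) ≡.refl S (m Z.· (λ _ → ℤ.0ℤ))))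
        (ℤ.+-monoˡ-≤ S (mg≥0 zero))
      on-F : ∀ i → F i ≡ true → m Z.· pointℤ i ≡ ℤ.0ℤ
      on-F i Fi≡t = ≡.trans (≡.sym restricted≡) (ℤ.≤-antisym
        (decidable-stable (_ ℤ.≤? _) λ 0<mi → Z.sum-positive _ m≥0 i
          (0<mi ∘ ≡.subst (ℤ._≤ ℤ.0ℤ) (ℤ.*-identityˡ (m Z.· restricted i))) S≤0)
        (mg≥0 (suc (suc i))))
        where
        m≥0 : ∀ i → ℤ.0ℤ ℤ.≤ ℤ.1ℤ ℤ.* m Z.· restricted i
        m≥0 i = ≡.subst (ℤ.0ℤ ℤ.≤_) (≡.sym (ℤ.*-identityˡ (m Z.· restricted i))) (mg≥0 (suc (suc i)))
        restricted≡ : m Z.· restricted i ≡ m Z.· pointℤ i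
        restricted≡ = Z.·-congʳ m λ x →
          ≡.trans (≡.cong (λ b → + (if b then 1 else 0) ℤ.* pointℤ i x) Fi≡t) (ℤ.*-identityˡ (pointℤ i x))

-- Two-level separation

module Tilting (O : OrderedDomain) where
  open OrderedDomain O
  open OrderedDomainProperties O
  open Solver

  Tilted : ∀ {d} (ℓ μ : Fin d → Carrier) (ℓb μb : Carrier) → Set
  Tilted ℓ μ ℓb μb = ∃[ α ] ∃[ β ] (∀ i → 0# ≤ α * μ i + β * ℓ i) × α * μb + β * ℓb < 0# ×
    (∀ i → ℓ i ≈ 0# → α * μ i + β * ℓ i ≈ 0#) ×
    ∃[ i₀ ] ¬ ℓ i₀ ≈ 0# × α * μ i₀ + β * ℓ i₀ ≈ 0#

  -- Tilting ℓ towards μ until a further index gets value zero.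
  tilt-values : ∀ {d} (ℓ μ : Fin d → Carrier) ℓb μb → (∀ i → 0# ≤ ℓ i) → ℓb < 0# →
    (∀ i → ℓ i ≈ 0# → μ i ≈ 0#) →
    ∀ w → 0# < ℓ w → μ w ≤ 0# → μb ≤ 0# → (μ w < 0# ⊎ μb < 0#) → Tilted ℓ μ ℓb μb
  tilt-values {d} ℓ μ ℓb μb ℓ≥0 ℓb<0 μ⊆ℓ w 0<ℓw μw≤0 μb≤0 strict
    = from (argmin {P = Pos} {_≲_ = _≲_} (λ i → ¬? (ℓ i ≤? 0#)) (λ i j → total _ _)
        (λ {i} {j} {k} → ≲-trans {i} {j} {k}) (w , 0<ℓw))
    where
    Pos = λ i → 0# < ℓ i
    -- Comparison of the ratios μ / ℓ at i and j with denominators cleared.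
    _≲_ : Rel (Fin d) 0ℓ
    i ≲ j = μ i * ℓ j ≤ μ j * ℓ i
    ≲-trans : ∀ {i j k} → 0# < ℓ j → i ≲ j → j ≲ k → i ≲ k
    ≲-trans {i} {j} {k} 0<ℓj i≲j j≲k = 0≤y-x⇒x≤y (*-cancelˡ-nonneg 0<ℓj
      (≤-respʳ
        (solve 6 (λ mi yi mj yj mk yk →
            yk :* (mj :* yi :- mi :* yj) :+ yi :* (mk :* yj :- mj :* yk) := yj :* (mk :* yi :- mi :* yk))
          refl (μ i) (ℓ i) (μ j) (ℓ j) (μ k) (ℓ k))
        (+-nonneg (*-nonneg (ℓ≥0 k) (x≤y⇒0≤y-x i≲j)) (*-nonneg (ℓ≥0 i) (x≤y⇒0≤y-x j≲k)))))
    module From (i₀ : Fin d) (0<ℓi₀ : 0# < ℓ i₀) (min : ∀ i → 0# < ℓ i → i₀ ≲ i) where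
      -- Where ℓ is positive, α μ + β ℓ is a positive multiple of the excess of the ratio μ / ℓ over
      -- its minimum, which is attained at i₀.
      α = ℓ i₀
      β = - μ i₀
      zeros : ∀ i → ℓ i ≈ 0# → α * μ i + β * ℓ i ≈ 0#
      zeros i ℓi≈0 = trans (+-cong (trans (*-congˡ (μ⊆ℓ i ℓi≈0)) (zeroʳ α)) (trans (*-congˡ ℓi≈0) (zeroʳ β)))
        (+-identityˡ 0#)
      ≥0 : ∀ i → 0# ≤ α * μ i + β * ℓ i
      ≥0 i with ℓ i ≤? 0#
      ... | yes ℓi≤0 = ≤-reflexive (sym (zeros i (antisym ℓi≤0 (ℓ≥0 i))))
      ... | no 0<ℓi = ≤-respʳ
        (solve 4 (λ mi yi m₀ y₀ → mi :* y₀ :- m₀ :* yi := y₀ :* mi :+ :- m₀ :* yi) refl (μ i) (ℓ i) (μ i₀) α)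
        (x≤y⇒0≤y-x (min i 0<ℓi))
      ℓwβ≈ : (μ w * α - μ i₀ * ℓ w) + α * - μ w ≈ ℓ w * β
      ℓwβ≈ = solve 4 (λ mw yw m₀ y₀ → (mw :* y₀ :- m₀ :* yw) :+ y₀ :* (:- mw) := yw :* (:- m₀)) refl
        (μ w) (ℓ w) (μ i₀) α
      -- The minimal ratio is at most the ratio at w, which is not positive. So β ℓ contributes
      -- nothing positive at b.
      0≤β : 0# ≤ β
      0≤β = *-cancelˡ-nonneg 0<ℓw (≤-respʳ ℓwβ≈
        (+-nonneg (x≤y⇒0≤y-x (min w 0<ℓw)) (*-nonneg (<⇒≤ 0<ℓi₀) (x≤0⇒0≤-x μw≤0))))
      0<β : μ w < 0# → 0# < β
      0<β μw<0 β≤0 = +-nonneg-pos (x≤y⇒0≤y-x (min w 0<ℓw)) (*-positive 0<ℓi₀ (x<0⇒0<-x μw<0))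
        (≤-reflexive (trans ℓwβ≈ (trans (*-congˡ (antisym β≤0 0≤β)) (zeroʳ _))))
      0<- : μ w < 0# ⊎ μb < 0# → 0# < α * - μb + β * - ℓb
      0<- (inj₁ μw<0) = +-nonneg-pos (*-nonneg (<⇒≤ 0<ℓi₀) (x≤0⇒0≤-x μb≤0))
                          (*-positive (0<β μw<0) (x<0⇒0<-x ℓb<0))
      0<- (inj₂ μb<0) = +-pos-nonneg (*-positive 0<ℓi₀ (x<0⇒0<-x μb<0))
                          (*-nonneg 0≤β (<⇒≤ (x<0⇒0<-x ℓb<0)))
      <0 : α * μb + β * ℓb < 0#
      <0 0≤ = +-pos-nonneg (0<- strict) 0≤ (≤-reflexive
        (solve 4 (λ α β s t → (α :* :- s :+ β :* :- t) :+ (α :* s :+ β :* t) := con ℤ.0ℤ) refl α β μb ℓb))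

    from : ∃[ i₀ ] 0# < ℓ i₀ × (∀ i → 0# < ℓ i → i₀ ≲ i) → Tilted ℓ μ ℓb μb
    from (i₀ , 0<ℓi₀ , min) = α , β , ≥0 , <0 , zeros , i₀ , <⇒≉ 0<ℓi₀ ∘ sym ,
      solve 2 (λ y₀ m₀ → y₀ :* m₀ :+ (:- m₀) :* y₀ := con ℤ.0ℤ) refl α (μ i₀)
      where open From i₀ 0<ℓi₀ min

module Facets (O : OrderedDomain) {d N : ℕ} (p : Fin d → Fin N → Bool) where
  open OrderedDomain O
  open OrderedDomainProperties O
  open IntegerCoefficients commutativeRing using (nat; int; *-homo)
  open Indicators commutativeRing
  open RingProperties ring using (-1*x≈-x; -0#≈0#)
  open Solver
  open Tilting O
  open Points p
  open SemiringSum semiring using (sum; sum-cong-≋; sum-replicate-zero)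

  point : Fin d → Vector Carrier N
  point i x = bit (p i x)

  nat-nonneg : ∀ n → 0# ≤ nat n
  nat-nonneg zero    = ≤-refl
  nat-nonneg (suc n) = +-nonneg (<⇒≤ 0<1) (nat-nonneg n)

  nat-positive : ∀ {n} → 0 ℕ.< n → 0# < nat n
  nat-positive {suc n} _ = +-pos-nonneg 0<1 (nat-nonneg n)

  int-nonneg : ∀ {i} → ℤ.0ℤ ℤ.≤ i → 0# ≤ int i
  int-nonneg {+ n} _ = nat-nonneg n

  int-negative : ∀ {i} → ¬ ℤ.0ℤ ℤ.≤ i → int i < 0#
  int-negative {+ n}      i<0 = contradiction (ℤ.+≤+ ℕ.z≤n) i<0
  int-negative { -[1+ n ]} _ 0≤ = +-nonneg-pos 0≤ (nat-positive {suc n} (ℕ.s≤s ℕ.z≤n))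
    (≤-reflexive (-‿inverseˡ _))

  -- An integral identity between multisets of points survives the map from ℤ, so every linear form
  -- over the domain, integral or not, weighs both sides equally.
  weigh-respects-~ : ∀ a b → a ~ b → ∀ y →
    sum (λ i → nat (a i) * y · point i) ≈ sum (λ i → nat (b i) * y · point i)
  weigh-respects-~ a b a~b y = trans (expand a) (trans
    (·-congʳ y λ x → reflexive (≡.cong int (a~b x))) (sym (expand b)))
    where
    expand : ∀ a → sum (λ i → nat (a i) * y · point i) ≈
      y · (λ x → int (sumℤ (λ i → + a i ℤ.* pointℤ i x)))
    expand a = trans (sym (·-sum y (nat ∘ a) point)) (·-congʳ y λ x →
      sym (trans (int-sum (λ i → + a i ℤ.* pointℤ i x)) (sum-cong-≋ λ i →
        trans (*-homo (+ a i) (pointℤ i x)) (*-congˡ (int-bit (p i x))))))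

  int-· : ∀ m i → (int ∘ m) · point i ≈ int (m Z.· pointℤ i)
  int-· m i = sym (trans (int-sum (λ x → m x ℤ.* pointℤ i x)) (sum-cong-≋ λ x →
    trans (*-homo (m x) (pointℤ i x)) (*-congˡ (int-bit (p i x)))))

  Nonneg : Vector Carrier N → Set
  Nonneg y = ∀ i → 0# ≤ y · point i

  support : Vector Carrier N → Subset d
  support y = Vec.tabulate λ i → does (¬? (y · point i ≟ 0#))

  ∈-support⁺ : ∀ y {i} → ¬ y · point i ≈ 0# → i ∈ˢ support y
  ∈-support⁺ y {i} ≉0 = Vec.lookup⇒[]= i _
    (≡.trans (Vec.lookup∘tabulate _ i) (dec-true (¬? (y · point i ≟ 0#)) ≉0))

  ∈-support⁻ : ∀ y {i} → i ∈ˢ support y → ¬ y · point i ≈ 0#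
  ∈-support⁻ y {i} i∈ ≈0 = case ≡.trans (≡.sym (Vec.[]=⇒lookup i∈))
    (≡.trans (Vec.lookup∘tabulate _ i) (dec-false (¬? (y · point i ≟ 0#)) (λ ≉0 → ≉0 ≈0))) of λ ()

  tilt : ∀ {y m b} → Nonneg y → y · b < 0# → (∀ i → y · point i ≈ 0# → m · point i ≈ 0#) →
    ∀ w → 0# < y · point w → m · point w ≤ 0# → m · b ≤ 0# → (m · point w < 0# ⊎ m · b < 0#) →
    ∃[ y′ ] Nonneg y′ × y′ · b < 0# × support y′ ⊂ support y
  tilt {y} {m} {b} y≥0 yb<0 m⊆y w 0<yw mw≤0 mb≤0 strict
    = from (tilt-values (λ i → y · point i) (λ i → m · point i) (y · b) (m · b) y≥0 yb<0 m⊆y w 0<yw mw≤0 mb≤0 strict)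
    where
    from : Tilted (λ i → y · point i) (λ i → m · point i) (y · b) (m · b) →
           ∃[ y′ ] Nonneg y′ × y′ · b < 0# × support y′ ⊂ support y
    from (α , β , ≥0 , <0 , zeros , i₀ , yi₀≉0 , new-zero) =
      y′ , (λ i → ≤-respʳ (sym (value (point i))) (≥0 i)) , (λ 0≤ → <0 (≤-respʳ (value b) 0≤)) ,
      (λ {i} i∈ → ∈-support⁺ y λ yi≈0 → ∈-support⁻ y′ i∈ (trans (value (point i)) (zeros i yi≈0))) ,
      i₀ , ∈-support⁺ y yi₀≉0 , λ i₀∈ → ∈-support⁻ y′ i₀∈ (trans (value (point i₀)) new-zero)
      where
      y′ = λ x → α * m x + β * y x
      value : ∀ a → y′ · a ≈ α * m · a + β * y · a
      value a = ·-linearˡ α m β y a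

  TwoLevel : Vector Carrier N → Set
  TwoLevel y = ∃[ α ] 0# < α × (∀ i → y · point i ≈ 0# ⊎ y · point i ≈ α)

  levels : (ℓ : Fin d → Carrier) → (∀ i → 0# ≤ ℓ i) →
    (∃[ α ] 0# < α × (∀ i → ℓ i ≈ 0# ⊎ ℓ i ≈ α)) ⊎ (∃[ v ] ∃[ w ] 0# < ℓ w × ℓ w < ℓ v)
  levels ℓ ℓ≥0
    with Fin.any? (λ v → Fin.any? λ w → ¬? (ℓ w ≤? 0#) ×-dec ¬? (ℓ v ≤? ℓ w)) | Fin.any? (λ w → ¬? (ℓ w ≤? 0#))
  ... | yes gap | _ = inj₂ gap
  -- All values are zero; 1 is an arbitrary positive level that is not attained.
  ... | no _    | no none = inj₁ (1# , 0<1 , λ i → inj₁ (antisym (≮⇒≥ λ 0<ℓi → none (i , 0<ℓi)) (ℓ≥0 i)))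
  ... | no ¬gap | yes (w , 0<ℓw) = inj₁ (ℓ w , 0<ℓw , level)
    where
    level : ∀ i → ℓ i ≈ 0# ⊎ ℓ i ≈ ℓ w
    level i with ℓ i ≤? 0#
    ... | yes ℓi≤0 = inj₁ (antisym ℓi≤0 (ℓ≥0 i))
    ... | no 0<ℓi  = inj₂ (antisym (≮⇒≥ λ ℓw<ℓi → ¬gap (i , w , 0<ℓw , ℓw<ℓi))
                                   (≮⇒≥ λ ℓi<ℓw → ¬gap (w , i , 0<ℓi , ℓi<ℓw)))

  module _ (exchange : Exchange) where

    no-gap : ∀ y → Nonneg y → ∀ v w → 0# < y · point w → y · point w < y · point v →
      ¬ Relation (λ i → does (y · point i ≟ 0#)) v w
    no-gap y y≥0 v w 0<yw yw<yv (k , a , b , ka~b , a-off , b-off) = ¬v-splits (exchange w≢v k a b ka~b 0<bv)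
      where
      ℓ = λ i → y · point i
      w≢v : w ≢ v
      w≢v ≡.refl = yw<yv ≤-refl
      off : ∀ {i} → 0# < ℓ i → does (ℓ i ≟ 0#) ≡ false
      off {i} 0<ℓi = dec-false (ℓ i ≟ 0#) (<⇒≉ 0<ℓi ∘ sym)
      nat-δ : ∀ i → nat (δ w i) ≈ bit (does (i Fin.≟ w))
      nat-δ i with does (i Fin.≟ w)
      ... | true  = +-identityʳ 1#
      ... | false = refl
      a-term : ∀ i → Dec (ℓ i ≈ 0#) → nat (a i) * ℓ i ≈ bit (does (i Fin.≟ w)) * ℓ i
      a-term i (yes ℓi≈0) = trans (trans (*-congˡ ℓi≈0) (zeroʳ _)) (sym (trans (*-congˡ ℓi≈0) (zeroʳ _)))
      a-term i (no ℓi≉0)  = *-congʳ (trans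
        (reflexive (≡.cong nat (a-off i (dec-false (ℓ i ≟ 0#) ℓi≉0)))) (nat-δ i))
      weight-of-a : sum (λ i → nat (a i) * ℓ i) ≈ ℓ w
      weight-of-a = trans (sum-cong-≋ λ i → a-term i (ℓ i ≟ 0#)) (sum-indicator w ℓ)
      term-nonneg : ∀ (a : Fin d → ℕ) i → 0# ≤ nat (a i) * ℓ i
      term-nonneg a i = *-nonneg (nat-nonneg (a i)) (y≥0 i)
      -- Otherwise b would be supported on the zero set of y and weigh nothing, while the multiple
      -- of a weighs at least as much as w.
      0<bv : 0 ℕ.< b v
      0<bv = ℕ.n≢0⇒n>0 λ bv≡0 → sum-positive _ (term-nonneg (λ i → suc k ℕ.* a i)) w
        (*-positive (nat-positive {suc k ℕ.* a w} (≡.subst (λ z → 0 ℕ.< suc k ℕ.* z) (≡.sym aw≡1) (ℕ.s≤s ℕ.z≤n))) 0<yw)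
        (≤-reflexive (trans (weigh-respects-~ (λ i → suc k ℕ.* a i) b ka~b y)
          (trans (sum-cong-≋ (λ i → b-term bv≡0 i (ℓ i ≟ 0#) (i Fin.≟ v))) (sum-replicate-zero d))))
        where
        aw≡1 : a w ≡ 1
        aw≡1 = ≡.trans (a-off w (off 0<yw)) (≡.cong (λ t → if t then 1 else 0) (dec-true (w Fin.≟ w) ≡.refl))
        b-term : b v ≡ 0 → ∀ i → Dec (ℓ i ≈ 0#) → Dec (i ≡ v) → nat (b i) * ℓ i ≈ 0#
        b-term _    i (yes ℓi≈0) _ = trans (*-congˡ ℓi≈0) (zeroʳ _)
        b-term bv≡0 i (no _) (yes ≡.refl) = trans (*-congʳ (reflexive (≡.cong nat bv≡0))) (zeroˡ _)
        b-term _    i (no ℓi≉0) (no i≢v) = trans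
          (*-congʳ (reflexive (≡.cong nat (b-off i (dec-false (ℓ i ≟ 0#) ℓi≉0) i≢v)))) (zeroˡ _)
      ¬v-splits : ¬ (∃[ u ] a ~ u × 0 ℕ.< u v)
      ¬v-splits (u , a~u , 0<uv) = yw<yv (≤-trans (ℓv≤ (u v) 0<uv)
        (≤-trans (term≤sum (λ i → nat (u i) * ℓ i) (term-nonneg u) v)
          (≤-reflexive (trans (sym (weigh-respects-~ a u a~u y)) weight-of-a))))
        where
        ℓv≤ : ∀ n → 0 ℕ.< n → ℓ v ≤ nat n * ℓ v
        ℓv≤ (suc n) _ = ≤-respʳ (sym (distribʳ (ℓ v) 1# (nat n)))
          (≤-respˡ (trans (+-identityʳ _) (*-identityˡ _)) (+-monoʳ-≤ (1# * ℓ v) (*-nonneg (nat-nonneg n) (y≥0 v))))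

    -- By `no-gap` there is no relation, so a functional m exists. If m is nonpositive at b, tilting
    -- towards m works, since m is negative at w. Otherwise -m is negative at b and nonpositive at
    -- v, and v plays the part of w. In each case only one of the two inequalities is known to be
    -- strict, which is why `tilt` accepts either.
    reduce : ∀ {b} y → Nonneg y → y · b < 0# → ∀ v w → 0# < y · point w → y · point w < y · point v →
      ∃[ y′ ] Nonneg y′ × y′ · b < 0# × support y′ ⊂ support y
    reduce {b} y y≥0 yb<0 v w 0<yw yw<yv = from (relation-or-functional F v w)
      where
      F = λ i → does (y · point i ≟ 0#)
      from : Relation F v w ⊎ Functional F v w → ∃[ y′ ] Nonneg y′ × y′ · b < 0# × support y′ ⊂ support y
      from (inj₁ rel) = contradiction rel (no-gap y y≥0 v w 0<yw yw<yv)
      from (inj₂ (m , m-zero , mv≥0 , mw<0)) = direction (mᴿ · b ≤? 0#)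
        where
        mᴿ = int ∘ m
        -- Negation in the shape of a linear combination, so that `·-linearˡ` computes its values.
        -m = λ x → - 1# * mᴿ x + 0# * mᴿ x
        -m·≈ : ∀ a → -m · a ≈ - (mᴿ · a)
        -m·≈ a = trans (·-linearˡ (- 1#) mᴿ 0# mᴿ a)
          (trans (+-cong (-1*x≈-x (mᴿ · a)) (zeroˡ _)) (+-identityʳ _))
        mᴿ-zero : ∀ i → y · point i ≈ 0# → mᴿ · point i ≈ 0#
        mᴿ-zero i yi≈0 = trans (int-· m i) (reflexive (≡.cong int (m-zero i (dec-true (y · point i ≟ 0#) yi≈0))))
        mᴿw<0 : mᴿ · point w < 0#
        mᴿw<0 = <-respˡ (sym (int-· m w)) (int-negative mw<0)
        0≤mᴿv : 0# ≤ mᴿ · point v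
        0≤mᴿv = ≤-respʳ (sym (int-· m v)) (int-nonneg mv≥0)
        direction : Dec (mᴿ · b ≤ 0#) → ∃[ y′ ] Nonneg y′ × y′ · b < 0# × support y′ ⊂ support y
        direction (yes mb≤0) = tilt y≥0 yb<0 mᴿ-zero w 0<yw (<⇒≤ mᴿw<0) mb≤0 (inj₁ mᴿw<0)
        direction (no 0<mb) = tilt y≥0 yb<0
          (λ i yi≈0 → trans (-m·≈ (point i)) (trans (-‿cong (mᴿ-zero i yi≈0)) -0#≈0#))
          v (≤-<-trans (<⇒≤ 0<yw) yw<yv)
          (≤-respˡ (sym (-m·≈ (point v))) (0≤x⇒-x≤0 0≤mᴿv))
          (<⇒≤ -mb<0) (inj₂ -mb<0)
          where
          -mb<0 : -m · b < 0#
          -mb<0 = <-respˡ (sym (-m·≈ b)) λ 0≤-mb →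
            +-nonneg-pos 0≤-mb 0<mb (≤-reflexive (-‿inverseˡ _))

    -- Each reduction strictly shrinks the finite set of points with nonzero value, and reduction is
    -- possible as long as two different positive values are left.
    two-level-separation : ∀ {b} y → Nonneg y → y · b < 0# → ∃[ y′ ] TwoLevel y′ × y′ · b < 0#
    two-level-separation {b} y y≥0 yb<0 = go y y≥0 yb<0 (⊂-wellFounded (support y))
      where
      go : ∀ y → Nonneg y → y · b < 0# → Acc _⊂_ (support y) → ∃[ y′ ] TwoLevel y′ × y′ · b < 0#
      go y y≥0 yb<0 (acc rs) = [ (λ two-level → y , two-level , yb<0) , recurse ]′ (levels (λ i → y · point i) y≥0)
        where
        recurse : ∃[ v ] ∃[ w ] 0# < y · point w × y · point w < y · point v → ∃[ y′ ] TwoLevel y′ × y′ · b < 0#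
        recurse (v , w , 0<yw , yw<yv) =
          let y′ , y′≥0 , y′b<0 , y′⊂y = reduce y y≥0 yb<0 v w 0<yw yw<yv
          in go y′ y′≥0 y′b<0 (rs y′⊂y)

-- Permutation summability

-- The extra coordinate, constantly 1, turns affine forms on matrices into linear ones and convex
-- hulls into slices of cones. It also makes `_~_` preserve the number of points.
homogeneous : ∀ {d n} → (Fin d → Permutation′ n) → Fin d → Fin (suc (n ℕ.* n)) → Bool
homogeneous σ i zero        = true
homogeneous {n = n} σ i (suc x) = uncurry (λ j k → does (σ i ⟨$⟩ʳ k Fin.≟ j)) (remQuot n x)

module PermutationPoints {d n : ℕ} (σ : Fin d → Permutation′ n) where
  open Points (homogeneous σ) public

  permℤ : Fin d → Fin n → Fin n → ℤ
  permℤ i j k = bitℤ (does (σ i ⟨$⟩ʳ k Fin.≟ j))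

  entry : (Fin d → ℕ) → Fin n → Fin n → ℤ
  entry a j k = sumℤ λ i → + a i ℤ.* permℤ i j k

  ~⇒entry : ∀ a b → a ~ b → ∀ j k → entry a j k ≡ entry b j k
  ~⇒entry a b a~b j k = ≡.subst
    (λ (j , k) → entry a j k ≡ entry b j k) (Fin.remQuot-combine j k) (a~b (suc (combine j k)))

  entry-cong : ∀ {a b} → (∀ i → a i ≡ b i) → ∀ j k → entry a j k ≡ entry b j k
  entry-cong a≗b j k = sumℤ-cong λ i → ≡.cong (λ t → + t ℤ.* permℤ i j k) (a≗b i)

  entry-scale : ∀ m a j k → entry (λ i → m ℕ.* a i) j k ≡ + m ℤ.* entry a j k
  entry-scale m a j k = ≡.trans
    (sumℤ-cong λ i → ≡.trans (≡.cong (ℤ._* permℤ i j k) (ℤ.pos-* m (a i)))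
      (ℤ.*-assoc (+ m) (+ a i) (permℤ i j k)))
    (≡.sym (*-distribˡ-sumℤ {d} (+ m) (λ i → + a i ℤ.* permℤ i j k)))

  entry-+ : ∀ a b j k → entry (λ i → a i ℕ.+ b i) j k ≡ entry a j k ℤ.+ entry b j k
  entry-+ a b j k = ≡.trans
    (sumℤ-cong λ i → ℤ.*-distribʳ-+ (permℤ i j k) (+ a i) (+ b i))
    (sumℤ-+ {d} _ _)

  -- A permutation matrix has exactly one 1 in each column, so a column total counts the
  -- permutations with multiplicity.
  column-sum : ∀ a k → sumℤ (λ j → entry a j k) ≡ sumℤ (λ i → + a i ℤ.* ℤ.1ℤ)
  column-sum a k = ≡.trans (sumℤ-comm {n} {d} (λ j i → + a i ℤ.* permℤ i j k)) (sumℤ-cong λ i →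
    ≡.trans (≡.sym (*-distribˡ-sumℤ {n} (+ a i) (λ j → permℤ i j k))) (≡.cong (+ a i ℤ.*_)
      (≡.trans (sumℤ-cong λ j → ≡.trans
          (≡.cong bitℤ (does-⇔ (mk⇔ ≡.sym ≡.sym) (σ i ⟨$⟩ʳ k Fin.≟ j) (j Fin.≟ σ i ⟨$⟩ʳ k)))
          (≡.sym (ℤ.*-identityʳ (bitℤ (does (j Fin.≟ σ i ⟨$⟩ʳ k))))))
        (sumℤ-indicator (σ i ⟨$⟩ʳ k) (λ _ → ℤ.1ℤ)))))

  entry⇒~ : Fin n → ∀ a b → (∀ j k → entry a j k ≡ entry b j k) → a ~ b
  entry⇒~ k a b eq zero    = ≡.trans (≡.sym (column-sum a k))
    (≡.trans (sumℤ-cong λ j → eq j k) (column-sum b k))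
  entry⇒~ k a b eq (suc x) = uncurry eq (remQuot n x)

-- Summability speaks of families and `Exchange` of multiplicities; this and `tally` translate
-- between them. All that is needed of the translation is that sums of a test function g agree.
enumerate : ∀ {d} (a : Fin d → ℕ) → ∃[ m ] Σ[ τ ∈ (Fin m → Fin d) ]
            (∀ g → sumℤ (g ∘ τ) ≡ sumℤ (λ i → + a i ℤ.* g i))
enumerate {zero}  a = 0 , (λ ()) , λ g → ≡.refl
enumerate {suc d} a with enumerate (a ∘ suc)
... | m′ , τ′ , eq′ = prepend (a zero)
  where
  prepend : ∀ n → ∃[ m ] Σ[ τ ∈ (Fin m → Fin (suc d)) ]
    (∀ g → sumℤ (g ∘ τ) ≡ + n ℤ.* g zero ℤ.+ sumℤ (λ i → + a (suc i) ℤ.* g (suc i)))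
  prepend zero    = m′ , suc ∘ τ′ , λ g → ≡.trans (eq′ (g ∘ suc)) (≡.sym (ℤ.+-identityˡ _))
  prepend (suc n) with prepend n
  ... | m , τ , eq = suc m , zero Vector.∷ τ , λ g → ≡.trans (≡.cong (λ t → g zero ℤ.+ t) (eq g))
    (≡.trans (≡.sym (ℤ.+-assoc (g zero) _ _))
      (≡.cong (ℤ._+ _) (≡.sym (ℤ.suc-* (+ n) (g zero)))))

tally : ∀ {l d} → (Fin l → Fin d) → Fin d → ℕ
tally {zero}  τ i = 0
tally {suc l} τ i = (if does (i Fin.≟ τ zero) then 1 else 0) ℕ.+ tally (τ ∘ suc) i

sum-tally : ∀ {l d} (τ : Fin l → Fin d) g → sumℤ (λ i → + tally τ i ℤ.* g i) ≡ sumℤ (g ∘ τ)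
sum-tally {zero}  {d} τ g = sumℤ-zero d
sum-tally {suc l} {d} τ g = ≡.trans
  (sumℤ-cong λ i → ≡.trans (ℤ.*-distribʳ-+ (g i) (+ (if does (i Fin.≟ τ zero) then 1 else 0)) (+ tally (τ ∘ suc) i))
    (≡.cong (λ t → t ℤ.* g i ℤ.+ + tally (τ ∘ suc) i ℤ.* g i) (+bit (does (i Fin.≟ τ zero)))))
  (≡.trans (sumℤ-+ {d} _ _) (≡.cong₂ ℤ._+_ (sumℤ-indicator (τ zero) g) (sum-tally (τ ∘ suc) g)))

module Summable {d n : ℕ} (σ : Fin d → Permutation′ n) (group : IsPermutationGroup σ) where
  open IsPermutationGroup group
  open PermutationPoints σ

  summable⇒exchange : PermutationSummable σ → Exchange
  summable⇒exchange summable {v} {w} w≢v k a b ka~b 0<bv = split n ≡.refl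
    where
    v⁻¹ = proj₁ (⁻¹-closed v)
    -- `_∘ₚ_` applies its left factor first, so `shift` multiplies the matrix from the left by the
    -- inverse of that of v. This only permutes rows, and it takes the matrix of v to the identity
    -- matrix, which summability can remove.
    shift unshift : Fin d → Fin d
    shift i   = proj₁ (∘-closed i v⁻¹)
    unshift l = proj₁ (∘-closed l v)

    shift-entry : ∀ i j k → permℤ (shift i) j k ≡ permℤ i (σ v ⟨$⟩ʳ j) k
    shift-entry i j k = ≡.cong bitℤ (does-⇔ (mk⇔
        (λ eq → ≡.trans (≡.sym (Perm.inverseʳ (σ v))) (≡.cong (σ v ⟨$⟩ʳ_) (≡.trans (≡.sym act) eq)))
        (λ eq → ≡.trans act (≡.trans (≡.cong (σ v ⟨$⟩ˡ_) eq) (Perm.inverseˡ (σ v)))))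
      (σ (shift i) ⟨$⟩ʳ k Fin.≟ j) (σ i ⟨$⟩ʳ k Fin.≟ σ v ⟨$⟩ʳ j))
      where
      act : σ (shift i) ⟨$⟩ʳ k ≡ σ v ⟨$⟩ˡ (σ i ⟨$⟩ʳ k)
      act = ≡.trans (proj₂ (∘-closed i v⁻¹) k) (proj₂ (⁻¹-closed v) (σ i ⟨$⟩ʳ k))

    unshift-entry : ∀ l j k → permℤ (unshift l) (σ v ⟨$⟩ʳ j) k ≡ permℤ l j k
    unshift-entry l j k = ≡.cong bitℤ (does-⇔ (mk⇔
        (λ eq → ≡.trans (≡.sym (Perm.inverseˡ (σ v))) (≡.trans
          (≡.cong (σ v ⟨$⟩ˡ_) (≡.trans (≡.sym act) eq)) (Perm.inverseˡ (σ v))))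
        (λ eq → ≡.trans act (≡.cong (σ v ⟨$⟩ʳ_) eq)))
      (σ (unshift l) ⟨$⟩ʳ k Fin.≟ σ v ⟨$⟩ʳ j) (σ l ⟨$⟩ʳ k Fin.≟ j))
      where
      act : σ (unshift l) ⟨$⟩ʳ k ≡ σ v ⟨$⟩ʳ (σ l ⟨$⟩ʳ k)
      act = proj₂ (∘-closed l v) k

    id-entry : ∀ j k → bitℤ (does (k Fin.≟ j)) ≡ permℤ v (σ v ⟨$⟩ʳ j) k
    id-entry j k = ≡.cong bitℤ (does-⇔ (mk⇔ (≡.cong (σ v ⟨$⟩ʳ_))
        (λ eq → ≡.trans (≡.sym (Perm.inverseˡ (σ v))) (≡.trans (≡.cong (σ v ⟨$⟩ˡ_) eq) (Perm.inverseˡ (σ v)))))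
      (k Fin.≟ j) (σ v ⟨$⟩ʳ k Fin.≟ σ v ⟨$⟩ʳ j))

    enum = enumerate a
    m = proj₁ enum
    τ : Fin m → Fin d
    τ = proj₁ (proj₂ enum)

    total-τ : ∀ j k → sumℤ (λ t → permℤ (shift (τ t)) j k) ≡ entry a (σ v ⟨$⟩ʳ j) k
    total-τ j k = ≡.trans (sumℤ-cong λ t → shift-entry (τ t) j k)
      (proj₂ (proj₂ enum) (λ i → permℤ i (σ v ⟨$⟩ʳ j) k))

    bit-nonneg : ∀ b → ℤ.0ℤ ℤ.≤ bitℤ b
    bit-nonneg true  = ℤ.+≤+ ℕ.z≤n
    bit-nonneg false = ℤ.≤-refl

    -- Where v has a 1, a positive multiple of the entry of a equals an entry of b, which is
    -- positive since b contains v. An integer with a positive multiple of this kind is at least 1,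
    -- so the factor `suc k` disappears.
    entry-bound : ∀ j k → permℤ v j k ℤ.≤ entry a j k
    entry-bound j i = bound (σ v ⟨$⟩ʳ i Fin.≟ j)
      where
      nonneg : ∀ (a : Fin d → ℕ) l → ℤ.0ℤ ℤ.≤ + a l ℤ.* permℤ l j i
      nonneg a l = Z.*-nonneg {+ a l} (ℤ.+≤+ ℕ.z≤n) (bit-nonneg (does (σ l ⟨$⟩ʳ i Fin.≟ j)))
      bound : (v? : Dec (σ v ⟨$⟩ʳ i ≡ j)) → bitℤ (does v?) ℤ.≤ entry a j i
      bound (no _)   = Z.sum-nonneg _ (nonneg a)
      bound (yes vi≡j) = ℤ.i<j⇒suc[i]≤j (ℤ.≰⇒> λ e≤0 → 0<entry-b (≡.subst₂ ℤ._≤_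
        (≡.trans (≡.sym (entry-scale (suc k) a j i)) (~⇒entry (λ l → suc k ℕ.* a l) b ka~b j i)) (ℤ.*-zeroʳ (+ suc k))
        (ℤ.*-monoˡ-≤-nonNeg (+ suc k) e≤0)))
        where
        0<entry-b : ¬ entry b j i ℤ.≤ ℤ.0ℤ
        0<entry-b = Z.sum-positive _ (nonneg b) v (≡.subst (λ t → ¬ (+ b v ℤ.* bitℤ t) ℤ.≤ ℤ.0ℤ)
          (≡.sym (dec-true (σ v ⟨$⟩ʳ i Fin.≟ j) vi≡j))
          λ bv≤0 → ℕ.<⇒≱ 0<bv (ℤ.drop‿+≤+ (≡.subst (ℤ._≤ ℤ.0ℤ) (ℤ.*-identityʳ (+ b v)) bv≤0)))

    nonneg : ∀ j k → ℤ.0ℤ ℤ.≤ sumℤ (λ t → permℤ (shift (τ t)) j k) ℤ.- bitℤ (does (k Fin.≟ j))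
    nonneg j k = ≡.subst₂ (λ s t → ℤ.0ℤ ℤ.≤ s ℤ.- t) (≡.sym (total-τ j k)) (≡.sym (id-entry j k))
      (ℤ.i≤j⇒0≤j-i (entry-bound (σ v ⟨$⟩ʳ j) k))

    summed = summable m (shift ∘ τ) nonneg
    υ = proj₁ (proj₂ summed)

    -- One copy of v, and the summands left after removing the identity, translated back.
    u : Fin d → ℕ
    u i = δ v i ℕ.+ tally (unshift ∘ υ) i

    entries : ∀ j k → entry a j k ≡ entry u j k
    entries j k = ≡.sym (begin
      entry u j k
        ≡⟨ ≡.trans (sumℤ-cong λ i → expand i) (sumℤ-+ {d} _ _) ⟩
      sumℤ (λ i → bitℤ (does (i Fin.≟ v)) ℤ.* permℤ i j k) ℤ.+ sumℤ (λ i → + tally (unshift ∘ υ) i ℤ.* permℤ i j k)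
        ≡⟨ ≡.cong₂ ℤ._+_ (sumℤ-indicator v (λ i → permℤ i j k)) (sum-tally (unshift ∘ υ) (λ i → permℤ i j k)) ⟩
      permℤ v j k ℤ.+ sumℤ (λ s → permℤ (unshift (υ s)) j k)
        ≡⟨ ≡.cong (λ t → permℤ v j k ℤ.+ t) (sumℤ-cong λ s →
             ≡.trans (≡.cong (λ t → permℤ (unshift (υ s)) t k) (≡.sym j≡)) (unshift-entry (υ s) j′ k)) ⟩
      permℤ v j k ℤ.+ sumℤ (λ s → permℤ (υ s) j′ k)
        ≡⟨ ≡.cong (λ t → permℤ v j k ℤ.+ t) (≡.sym (proj₂ (proj₂ summed) j′ k)) ⟩
      permℤ v j k ℤ.+ (sumℤ (λ t → permℤ (shift (τ t)) j′ k) ℤ.- bitℤ (does (k Fin.≟ j′)))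
        ≡⟨ ≡.cong₂ (λ s t → permℤ v j k ℤ.+ (s ℤ.- t))
             (≡.trans (total-τ j′ k) (≡.cong (λ t → entry a t k) j≡))
             (≡.trans (id-entry j′ k) (≡.cong (λ t → permℤ v t k) j≡)) ⟩
      permℤ v j k ℤ.+ (entry a j k ℤ.- permℤ v j k)
        ≡⟨ solve 2 (λ p e → p :+ (e :- p) := e) ≡.refl (permℤ v j k) (entry a j k) ⟩
      entry a j k ∎)
      where
      open ≡-Reasoning
      open Z.Solver
      j′ = σ v ⟨$⟩ˡ j
      j≡ : σ v ⟨$⟩ʳ j′ ≡ j
      j≡ = Perm.inverseʳ (σ v)
      expand : ∀ i → + u i ℤ.* permℤ i j k ≡
        bitℤ (does (i Fin.≟ v)) ℤ.* permℤ i j k ℤ.+ + tally (unshift ∘ υ) i ℤ.* permℤ i j k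
      expand i = ≡.trans (ℤ.*-distribʳ-+ (permℤ i j k) (+ δ v i) (+ tally (unshift ∘ υ) i))
        (≡.cong (λ t → t ℤ.* permℤ i j k ℤ.+ + tally (unshift ∘ υ) i ℤ.* permℤ i j k) (+bit (does (i Fin.≟ v))))

    0<uv : 0 ℕ.< u v
    0<uv = ≡.subst (λ t → 0 ℕ.< (if t then 1 else 0) ℕ.+ tally (unshift ∘ υ) v)
      (≡.sym (dec-true (v Fin.≟ v) ≡.refl)) (ℕ.s≤s ℕ.z≤n)

    split : ∀ n′ → n ≡ n′ → ∃[ u ] a ~ u × 0 ℕ.< u v
    -- For n = 0 all permutations agree, so distinctness would force w = v.
    split zero     ≡.refl = contradiction (distinct w v λ ()) w≢v
    split (suc n′) ≡.refl = u , entry⇒~ zero a u entries , 0<uv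

-- Polynomials as linear forms on functions of monomials

infix 4 _≟ᵐ_
_≟ᵐ_ : ∀ {k} (e m : Monomial k) → Dec (e ≡ m)
_≟ᵐ_ = Vec.≡-dec ℕ._≟_

infixl 6 _∙_
_∙_ : ∀ {k} → Monomial k → Monomial k → Monomial k
_∙_ = zipWith ℕ._+_

module Pairing (K : CommutativeRing 0ℓ 0ℓ) where
  open CommutativeRing K hiding (zero)
  open Polynomial rawRing public
  open SemiringIndicators semiring using (bit)
  open SemiringSum semiring using (sum)
  open RingProperties ring using (-‿distribˡ-*; -0#≈0#; -‿+-comm)
  open import Algebra.Properties.CommutativeSemigroup +-commutativeSemigroup using (interchange; x∙yz≈y∙xz)
  open import Algebra.Properties.CommutativeSemigroup *-commutativeSemigroup using () renaming (x∙yz≈y∙xz to x*yz≈y*xz)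
  open import Relation.Binary.Reasoning.Setoid setoid

  -- Coefficients, values at a point and coefficients of the toric image are all of this form for a
  -- suitable g, so one calculus serves the theta body and the toric ideal.
  ⟨_∣_⟩ : ∀ {k} → Poly k → (Monomial k → Carrier) → Carrier
  ⟨ p ∣ g ⟩ = foldr (λ (c , e) s → c * g e + s) 0# p

  at : ∀ {k} → Monomial k → Monomial k → Carrier
  at m e = bit (does (e ≟ᵐ m))

  coefficient≈ : ∀ {k} (p : Poly k) m → coefficient p m ≈ ⟨ p ∣ at m ⟩
  coefficient≈ []            m = refl
  coefficient≈ ((c , e) ∷ p) m with does (e ≟ᵐ m)
  ... | true  = +-cong (sym (*-identityʳ c)) (coefficient≈ p m)
  ... | false = trans (coefficient≈ p m) (sym (trans (+-congʳ (zeroʳ c)) (+-identityˡ _)))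

  pairing-cong : ∀ {k} (p : Poly k) {g h : Monomial k → Carrier} → (∀ e → g e ≈ h e) → ⟨ p ∣ g ⟩ ≈ ⟨ p ∣ h ⟩
  pairing-cong []            g≈h = refl
  pairing-cong ((c , e) ∷ p) g≈h = +-cong (*-congˡ (g≈h e)) (pairing-cong p g≈h)

  pairing-0 : ∀ {k} (p : Poly k) → ⟨ p ∣ (λ _ → 0#) ⟩ ≈ 0#
  pairing-0 []            = refl
  pairing-0 ((c , e) ∷ p) = trans (+-cong (zeroʳ c) (pairing-0 p)) (+-identityˡ 0#)

  pairing-+ : ∀ {k} (p : Poly k) g h → ⟨ p ∣ (λ e → g e + h e) ⟩ ≈ ⟨ p ∣ g ⟩ + ⟨ p ∣ h ⟩
  pairing-+ []            g h = sym (+-identityˡ 0#)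
  pairing-+ ((c , e) ∷ p) g h = trans (+-cong (distribˡ c (g e) (h e)) (pairing-+ p g h)) (interchange _ _ _ _)

  pairing-*ˡ : ∀ {k} (p : Poly k) x g → ⟨ p ∣ (λ e → x * g e) ⟩ ≈ x * ⟨ p ∣ g ⟩
  pairing-*ˡ []            x g = sym (zeroʳ x)
  pairing-*ˡ ((c , e) ∷ p) x g = trans (+-cong (x*yz≈y*xz c x (g e)) (pairing-*ˡ p x g)) (sym (distribˡ x _ _))

  pairing-*ʳ : ∀ {k} (p : Poly k) x g → ⟨ p ∣ (λ e → g e * x) ⟩ ≈ ⟨ p ∣ g ⟩ * x
  pairing-*ʳ p x g = trans (pairing-cong p λ e → *-comm (g e) x) (trans (pairing-*ˡ p x g) (*-comm x _))

  pairing-++ : ∀ {k} (p q : Poly k) g → ⟨ p ++ q ∣ g ⟩ ≈ ⟨ p ∣ g ⟩ + ⟨ q ∣ g ⟩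
  pairing-++ []            q g = sym (+-identityˡ _)
  pairing-++ ((c , e) ∷ p) q g = trans (+-congˡ (pairing-++ p q g)) (sym (+-assoc _ _ _))

  module _ {k : ℕ} where
    open RawRing (polyRing k) public using () renaming (_*_ to _⊛_; -_ to ⊖_)
    open SemiringOps (RawRing.rawSemiring (polyRing k)) public using () renaming (sum to ∑)

    pairing-neg : ∀ (p : Poly k) g → ⟨ ⊖ p ∣ g ⟩ ≈ - ⟨ p ∣ g ⟩
    pairing-neg []            g = sym -0#≈0#
    pairing-neg ((c , e) ∷ p) g = trans (+-cong (sym (-‿distribˡ-* c (g e))) (pairing-neg p g)) (-‿+-comm _ _)

    pairing-∑ : ∀ {r} (f : Fin r → Poly k) g → ⟨ ∑ f ∣ g ⟩ ≈ sum (λ i → ⟨ f i ∣ g ⟩)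
    pairing-∑ {zero}  f g = refl
    pairing-∑ {suc r} f g = trans (pairing-++ (f zero) (∑ (f ∘ suc)) g) (+-congˡ (pairing-∑ (f ∘ suc) g))

    pairing-* : ∀ (p q : Poly k) g → ⟨ p ⊛ q ∣ g ⟩ ≈ ⟨ p ∣ (λ e → ⟨ q ∣ (λ e′ → g (e ∙ e′)) ⟩) ⟩
    pairing-* []            q g = refl
    pairing-* ((c , e) ∷ p) q g = trans (pairing-++ (map _ q) (p ⊛ q) g) (+-cong (shift q) (pairing-* p q g))
      where
      shift : ∀ q → ⟨ map (λ (c′ , e′) → c * c′ , e ∙ e′) q ∣ g ⟩ ≈ c * ⟨ q ∣ (λ e′ → g (e ∙ e′)) ⟩
      shift []              = sym (zeroʳ c)
      shift ((c′ , e′) ∷ q) = trans (+-cong (*-assoc _ _ _) (shift q)) (sym (distribˡ c _ _))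

  remove : ∀ {k} → Monomial k → Poly k → Poly k
  remove m = filter λ (c , e) → ¬? (e ≟ᵐ m)

  pairing-remove : ∀ {k} (p : Poly k) m g → ⟨ p ∣ g ⟩ ≈ coefficient p m * g m + ⟨ remove m p ∣ g ⟩
  pairing-remove []            m g = sym (trans (+-congʳ (zeroˡ _)) (+-identityˡ 0#))
  pairing-remove ((c , e) ∷ p) m g with e ≟ᵐ m
  ... | yes ≡.refl = trans (+-congˡ (pairing-remove p e g))
    (trans (sym (+-assoc _ _ _)) (+-congʳ (sym (distribʳ (g e) c _))))
  ... | no _ = trans (+-congˡ (pairing-remove p m g)) (x∙yz≈y∙xz _ _ _)

  coefficient-remove : ∀ {k} (p : Poly k) m → coefficient (remove m p) m ≈ 0#
  coefficient-remove []            m = refl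
  coefficient-remove ((c , e) ∷ p) m with e ≟ᵐ m in eq
  ... | yes _  = coefficient-remove p m
  ... | no e≢m rewrite eq = coefficient-remove p m

  coefficient-remove-≢ : ∀ {k} (p : Poly k) m {m′} → m′ ≢ m → coefficient (remove m p) m′ ≈ coefficient p m′
  coefficient-remove-≢ p m {m′} m′≢m = sym (trans (coefficient≈ p m′) (trans (pairing-remove p m (at m′))
    (trans (+-cong (trans (*-congˡ (reflexive (≡.cong bit (dec-false (m ≟ᵐ m′) (m′≢m ∘ ≡.sym))))) (zeroʳ _))
      (sym (coefficient≈ (remove m p) m′))) (+-identityˡ _))))

  module _ (_≟_ : Decidable _≈_) where

    -- Terms may repeat and cancel, so the first listed monomial need not occur. Removing all of its
    -- terms at once replaces them by its coefficient and shortens the list.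
    nonzero-term : ∀ {k} (p : Poly k) g → (∃[ e ] Occurs p e × ¬ g e ≈ 0#) ⊎ ⟨ p ∣ g ⟩ ≈ 0#
    nonzero-term {k} p g = go p (<-wellFounded (length p))
      where
      go : ∀ (p : Poly k) → Acc ℕ._<_ (length p) → (∃[ e ] Occurs p e × ¬ g e ≈ 0#) ⊎ ⟨ p ∣ g ⟩ ≈ 0#
      go []              _        = inj₂ refl
      go p@((c , e) ∷ p′) (acc rs) = step (coefficient p e ≟ 0#) (g e ≟ 0#)
        where
        shorter : length (remove e p) ℕ.< length p
        shorter with e ≟ᵐ e
        ... | yes _  = ℕ.s≤s (List.length-filter _ p′)
        ... | no e≢e = contradiction ≡.refl e≢e
        rest : coefficient p e * g e ≈ 0# → (∃[ e ] Occurs p e × ¬ g e ≈ 0#) ⊎ ⟨ p ∣ g ⟩ ≈ 0#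
        rest head≈0 with go (remove e p) (rs shorter)
        ... | inj₂ tail≈0 = inj₂ (trans (pairing-remove p e g) (trans (+-cong head≈0 tail≈0) (+-identityˡ 0#)))
        ... | inj₁ (m , occurs , gm≉0) = inj₁ (m , (λ ≈0 → occurs (≈0′ ≈0 (m ≟ᵐ e))) , gm≉0)
          where
          ≈0′ : coefficient p m ≈ 0# → Dec (m ≡ e) → coefficient (remove e p) m ≈ 0#
          ≈0′ _  (yes ≡.refl) = coefficient-remove p e
          ≈0′ ≈0 (no m≢e)     = trans (coefficient-remove-≢ p e m≢e) ≈0
        step : Dec (coefficient p e ≈ 0#) → Dec (g e ≈ 0#) → _
        step (no occurs) (no ge≉0) = inj₁ (e , occurs , ge≉0)
        step (yes ≈0)    _         = rest (trans (*-congʳ ≈0) (zeroˡ _))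
        step _           (yes ≈0)  = rest (trans (*-congˡ ≈0) (zeroʳ _))

    -- `nonzero-term` is applied to g - h. Degree bounds concern occurring monomials only; this
    -- makes them control values, even if the list contains cancelling terms of higher degree.
    pairing-agree : ∀ {k} (p : Poly k) {g h} → (∀ e → Occurs p e → g e ≈ h e) → ⟨ p ∣ g ⟩ ≈ ⟨ p ∣ h ⟩
    pairing-agree p {g} {h} agree with nonzero-term p (λ e → g e - h e)
    ... | inj₁ (e , occurs , g-h≉0) = contradiction (trans (+-congʳ (agree e occurs)) (-‿inverseʳ _)) g-h≉0
    ... | inj₂ ≈0 = begin
      ⟨ p ∣ g ⟩                              ≈⟨ pairing-cong p (λ e → sym (trans (+-assoc _ _ _)
                                                  (trans (+-congˡ (-‿inverseˡ _)) (+-identityʳ _)))) ⟩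
      ⟨ p ∣ (λ e → g e - h e + h e) ⟩        ≈⟨ pairing-+ p _ _ ⟩
      ⟨ p ∣ (λ e → g e - h e) ⟩ + ⟨ p ∣ h ⟩  ≈⟨ +-congʳ ≈0 ⟩
      0# + ⟨ p ∣ h ⟩                         ≈⟨ +-identityˡ _ ⟩
      ⟨ p ∣ h ⟩                              ∎

-- The first theta body

unit : ∀ {k} → Fin k → Monomial k
unit {k} v = replicate k 0 [ v ]≔ 1

degree-0 : ∀ k → degree (replicate k 0) ≡ 0
degree-0 zero    = ≡.refl
degree-0 (suc k) = degree-0 k

degree-unit : ∀ {k} (v : Fin k) → degree (unit v) ≡ 1
degree-unit {suc k} zero = ≡.cong suc (degree-0 k)
degree-unit (suc v)      = degree-unit v

degree≡0 : ∀ {k} (e : Monomial k) → degree e ℕ.≤ 0 → e ≡ replicate k 0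
degree≡0 []         _   = ≡.refl
degree≡0 (zero ∷ e) e≤0 = ≡.cong (0 ∷_) (degree≡0 e e≤0)

degree≤1 : ∀ {k} (e : Monomial k) → degree e ℕ.≤ 1 → e ≡ replicate k 0 ⊎ ∃[ v ] e ≡ unit v
degree≤1 []               _         = inj₁ ≡.refl
degree≤1 (suc zero ∷ e) (s≤s e≤0) = inj₂ (zero , ≡.cong (1 ∷_) (degree≡0 e e≤0))
degree≤1 (zero ∷ e)     e≤1       with degree≤1 e e≤1
... | inj₁ e≡0       = inj₁ (≡.cong (0 ∷_) e≡0)
... | inj₂ (v , e≡v) = inj₂ (suc v , ≡.cong (0 ∷_) e≡v)

module Evaluation (K : CommutativeRing 0ℓ 0ℓ) where
  open CommutativeRing K hiding (zero)
  open Pairing K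
  open SemiringOps (RawRing.rawSemiring rawRing) using (product; _^_)
  open MonoidMult *-monoid using () renaming (×-homo-+ to ^-homo-*)
  open CommutativeMonoidSum *-commutativeMonoid using () renaming (∑-distrib-+ to product-*; sum-cong-≋ to product-cong)
  open SemiringSum semiring using (sum; sum-cong-≋; sum-replicate-zero)

  power : ∀ {k} → (Fin k → Carrier) → Monomial k → Carrier
  power s e = product λ i → s i ^ lookup e i

  power-∙ : ∀ {k} (s : Fin k → Carrier) e e′ → power s (e ∙ e′) ≈ power s e * power s e′
  power-∙ {k} s e e′ = trans
    (product-cong λ i → trans (reflexive (≡.cong (s i ^_) (Vec.lookup-zipWith ℕ._+_ i e e′)))
      (^-homo-* (s i) (lookup e i) (lookup e′ i)))
    (product-* {k} _ _)

  power-0 : ∀ {k} (s : Fin k → Carrier) → power s (replicate k 0) ≈ 1#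
  power-0 {zero}  s = refl
  power-0 {suc k} s = trans (*-identityˡ _) (power-0 (s ∘ suc))

  power-unit : ∀ {k} (s : Fin k → Carrier) v → power s (unit v) ≈ s v
  power-unit s zero    = trans (*-cong (*-identityʳ (s zero)) (power-0 (s ∘ suc))) (*-identityʳ _)
  power-unit s (suc v) = trans (*-identityˡ _) (power-unit (s ∘ suc) v)

  evaluate-* : ∀ {k} (s : Fin k → Carrier) p q → ⟨ p ⊛ q ∣ power s ⟩ ≈ ⟨ p ∣ power s ⟩ * ⟨ q ∣ power s ⟩
  evaluate-* s p q = trans (pairing-* p q (power s)) (trans
    (pairing-cong p λ e → trans (pairing-cong q (power-∙ s e)) (pairing-*ˡ q (power s e) (power s)))
    (pairing-*ʳ p _ (power s)))

  pairing-sum : ∀ {k r} (p : Poly k) (w : Fin r → Carrier) (g : Fin r → Monomial k → Carrier) →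
    ⟨ p ∣ (λ e → sum λ i → w i * g i e) ⟩ ≈ sum (λ i → w i * ⟨ p ∣ g i ⟩)
  pairing-sum {r = zero}  p w g = pairing-0 p
  pairing-sum {r = suc r} p w g = trans (pairing-+ p _ _)
    (+-cong (pairing-*ˡ p (w zero) (g zero)) (pairing-sum p (w ∘ suc) (g ∘ suc)))

  affine : ∀ {k} → Vector Carrier (suc k) → Poly k
  affine {k} z = (z zero , replicate k 0) ∷ List.tabulate λ v → z (suc v) , unit v

  pairing-tabulate : ∀ {k r} (c : Fin r → Carrier) (m : Fin r → Monomial k) g →
    ⟨ List.tabulate (λ v → c v , m v) ∣ g ⟩ ≈ sum (λ v → c v * g (m v))
  pairing-tabulate {r = zero}  c m g = refl
  pairing-tabulate {r = suc r} c m g = +-congˡ (pairing-tabulate (c ∘ suc) (m ∘ suc) g)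

  pairing-affine : ∀ {k} (z : Vector Carrier (suc k)) g →
    ⟨ affine z ∣ g ⟩ ≈ z zero * g (replicate k 0) + sum (λ v → z (suc v) * g (unit v))
  pairing-affine z g = +-congˡ (pairing-tabulate (z ∘ suc) unit g)

  affine-degree : ∀ {k} (z : Vector Carrier (suc k)) → DegreeAtMost 1 (affine z)
  affine-degree {k} z m occurs = decidable-stable (degree m ℕ.≤? 1) λ m≰1 → occurs
    (trans (coefficient≈ (affine z) m) (trans (pairing-affine z (at m))
      (trans (+-cong (vanish m≰1 (z zero) (replicate k 0) (ℕ.≤-trans (ℕ.≤-reflexive (degree-0 k)) z≤n))
          (trans (sum-cong-≋ λ v → vanish m≰1 (z (suc v)) (unit v) (ℕ.≤-reflexive (degree-unit v)))
            (sum-replicate-zero k)))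
        (+-identityˡ 0#))))
    where
    vanish : ¬ degree m ℕ.≤ 1 → ∀ c e → degree e ℕ.≤ 1 → c * at m e ≈ 0#
    vanish m≰1 c e e≤1 = trans (*-congˡ (reflexive (≡.cong (λ b → if b then 1# else 0#)
      (dec-false (e ≟ᵐ m) λ e≡m → m≰1 (≡.subst (λ m → degree m ℕ.≤ 1) e≡m e≤1))))) (zeroʳ c)

realDomain : CompleteOrderedField → OrderedDomain
realDomain ℝ = record
  { commutativeRing = commutativeRing
  ; isDecTotalOrder = isDecTotalOrder
  ; +-monoˡ-≤       = +-monoˡ-≤
  -- A product that is both nonnegative and at most 0 is 0, and dividing it by x would give y = 0.
  ; *-positive      = λ {x} {y} 0<x 0<y xy≤0 → 0<y (≤-reflexive (y≈0 0<x
                        (antisym xy≤0 (*-nonNegative (<⇒≤ 0<x) (<⇒≤ 0<y)))))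
  -- If 1 were at most 0, then -1 and hence its square 1 would be nonnegative, so 1 = 0.
  ; 0<1             = λ 1≤0 → 1≉0 (antisym 1≤0 (≤-respʳ
                        (trans (sym (-‿distribˡ-* 1# (- 1#))) (trans (-‿cong (*-identityˡ _)) (-‿involutive 1#)))
                        (*-nonNegative (0≤-1 1≤0) (0≤-1 1≤0))))
  }
  where
  open CompleteOrderedField ℝ
  open import Relation.Binary.Structures using (IsDecTotalOrder)
  open IsDecTotalOrder isDecTotalOrder using (antisym; total) renaming (reflexive to ≤-reflexive; ≤-resp-≈ to ≤-resp-≈)
  open RingProperties ring using (-‿distribˡ-*; -‿involutive)
  ≤-respʳ = proj₁ ≤-resp-≈
  <⇒≤ : ∀ {x} → ¬ x ≤ 0# → 0# ≤ x
  <⇒≤ {x} 0<x = [ (λ 0≤x → 0≤x) , (λ x≤0 → contradiction x≤0 0<x) ]′ (total 0# x)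
  0≤-1 : 1# ≤ 0# → 0# ≤ - 1#
  0≤-1 1≤0 = proj₂ ≤-resp-≈ (-‿inverseʳ 1#) (≤-respʳ (+-identityˡ (- 1#)) (+-monoˡ-≤ (- 1#) 1≤0))
  y≈0 : ∀ {x y} → ¬ x ≤ 0# → x * y ≈ 0# → y ≈ 0#
  y≈0 {x} {y} 0<x xy≈0 with inverse x (λ x≈0 → 0<x (≤-reflexive x≈0))
  ... | x⁻¹ , xx⁻¹≈1 = trans (sym (*-identityˡ y)) (trans (*-congʳ (trans (sym xx⁻¹≈1) (*-comm x x⁻¹)))
    (trans (*-assoc x⁻¹ x y) (trans (*-congˡ xy≈0) (zeroʳ x⁻¹))))

module Exactness (ℝ : CompleteOrderedField) {d n : ℕ} (σ : Fin d → Permutation′ n) where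
  private
    O = realDomain ℝ
  open OrderedDomain O
  open OrderedDomainProperties O
  open Facets O (homogeneous σ)
  open Points (homogeneous σ) using (Exchange)
  open Pairing commutativeRing
  open Evaluation commutativeRing
  open SemiringSum semiring using (sum; sum-cong-≋; *-distribˡ-sum)
  open Solver

  A : Matrix Carrier n → Set
  A = permMatrices ℝ σ

  I : Poly (n ℕ.* n) → Set
  I = vanishingIdeal ℝ A

  flat : Matrix Carrier n → Fin (n ℕ.* n) → Carrier
  flat X v = uncurry X (remQuot n v)

  lift : Matrix Carrier n → Vector Carrier (suc (n ℕ.* n))
  lift X zero    = 1#
  lift X (suc v) = flat X v

  eval-affine : ∀ z X → evalMatrix ℝ X (affine z) ≈ z · lift X
  eval-affine z X = trans (pairing-affine z (power (flat X)))
    (+-cong (*-congˡ (power-0 (flat X))) (sum-cong-≋ λ v → *-congˡ (power-unit (flat X) v)))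

  lift-perm : ∀ {X} i → (∀ j k → X j k ≈ permMatrix (RawRing.rawSemiring rawRing) (σ i) j k) → ∀ x → lift X x ≈ point i x
  lift-perm i X≈ zero    = refl
  lift-perm i X≈ (suc v) = X≈ _ _

  sos-nonneg : ∀ (f : Poly (n ℕ.* n)) → 1-SOSMod ℝ {n} I f → ∀ {Y} → A Y → 0# ≤ evalMatrix ℝ Y f
  sos-nonneg f (r , h , _ , f-∑h²∈I) {Y} Y∈A = ≤-respʳ (sym f≈) (sum-nonneg {r} _ λ i → square-nonneg _)
    where
    s = power (flat Y)
    squares = sum λ i → ⟨ h i ∣ s ⟩ * ⟨ h i ∣ s ⟩
    f≈ : ⟨ f ∣ s ⟩ ≈ squares
    f≈ = trans (solve 2 (λ x y → x := (x :+ :- y) :+ y) refl ⟨ f ∣ s ⟩ squares)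
      (trans (+-congʳ (trans
          (+-congˡ (-‿cong (sym (trans (pairing-∑ (λ i → h i ⊛ h i) s)
            (sum-cong-≋ λ i → evaluate-* (flat Y) (h i) (h i))))))
        (trans (+-congˡ (sym (pairing-neg (∑ λ i → h i ⊛ h i) s)))
        (trans (sym (pairing-++ f (⊖ ∑ λ i → h i ⊛ h i) s)) (f-∑h²∈I Y Y∈A))))) (+-identityˡ _))

  -- At a convex combination a polynomial of degree at most 1 takes the weighted mean of its values,
  -- and a 1-sos polynomial is nonnegative at every point of A.
  conv⊆TH₁ : ∀ {X} → conv ℝ A X → TH₁ ℝ {n} I X
  conv⊆TH₁ {X} (r , Y , w , Y∈A , w≥0 , ∑w≈1 , X≈) f f≤1 sos =
    ≤-respʳ (sym (trans (pairing-agree _≟_ f {power (flat X)} {λ e → sum λ i → w i * power (flat (Y i)) e}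
        λ e occurs → affine-monomial e (degree≤1 e (f≤1 e occurs)))
      (pairing-sum f w (λ i → power (flat (Y i))))))
      (sum-nonneg {r} _ λ i → *-nonneg (w≥0 i) (sos-nonneg f sos (Y∈A i)))
    where
    affine-monomial : ∀ e → e ≡ replicate _ 0 ⊎ (∃[ v ] e ≡ unit v) →
      power (flat X) e ≈ sum λ i → w i * power (flat (Y i)) e
    affine-monomial _ (inj₁ ≡.refl) = trans (power-0 (flat X)) (trans (sym ∑w≈1)
      (sum-cong-≋ λ i → sym (trans (*-congˡ (power-0 (flat (Y i)))) (*-identityʳ (w i)))))
    affine-monomial _ (inj₂ (v , ≡.refl)) = trans (power-unit (flat X) v)
      (trans (X≈ _ _) (sum-cong-≋ λ i → *-congˡ (sym (power-unit (flat (Y i)) v))))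

  positive-inverse : ∀ {x} → 0# < x → ∃[ y ] 0# < y × x * y ≈ 1#
  positive-inverse {x} 0<x with CompleteOrderedField.inverse ℝ x (<⇒≉ 0<x ∘ sym)
  ... | y , xy≈1 = y , (λ y≤0 → 0<1 (≤-respˡ xy≈1 (≤-respˡ
      (solve 2 (λ x y → :- (x :* :- y) := x :* y) refl x y)
      (0≤x⇒-x≤0 (*-nonneg (<⇒≤ 0<x) (x≤0⇒0≤-x y≤0)))))) , xy≈1

  cone⊆conv : ∀ {X} → InCone point (lift X) → conv ℝ A X
  cone⊆conv {X} (k , c , 0<k , c≥0 , eq) with positive-inverse 0<k
  ... | k⁻¹ , 0<k⁻¹ , kk⁻¹≈1 =
    d , (λ i → permMatrix (RawRing.rawSemiring rawRing) (σ i)) , (λ i → k⁻¹ * c i) ,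
    (λ i → i , λ j k → refl) , (λ i → *-nonneg (<⇒≤ 0<k⁻¹) (c≥0 i)) ,
    -- The leading coordinate of `lift X` is 1, so the cone identity says there that the scaled
    -- weights sum to 1.
    trans (sum-cong-≋ λ i → sym (*-identityʳ (k⁻¹ * c i))) (sym (scaled zero)) ,
    λ j k → trans (reflexive (≡.cong (uncurry X) (≡.sym (Fin.remQuot-combine j k))))
      (trans (scaled (suc (combine j k))) (sum-cong-≋ λ i → *-congˡ (reflexive
        (≡.cong (uncurry (permMatrix (RawRing.rawSemiring rawRing) (σ i))) (Fin.remQuot-combine j k)))))
    where
    scaled : ∀ x → lift X x ≈ sum (λ i → k⁻¹ * c i * point i x)
    scaled x = trans (sym (*-identityˡ _)) (trans (*-congʳ (trans (sym kk⁻¹≈1) (*-comm k k⁻¹)))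
      (trans (*-assoc _ _ _) (trans (*-congˡ (eq x)) (trans (*-distribˡ-sum k⁻¹ (λ i → c i * point i x))
        (sum-cong-≋ λ i → sym (*-assoc k⁻¹ (c i) (point i x)))))))

  TH₁⊆two-level-halfspace : ∀ {X} → TH₁ ℝ {n} I X → ∀ y → TwoLevel y → 0# ≤ y · lift X
  TH₁⊆two-level-halfspace {X} X∈TH₁ y (α , 0<α , levels) with positive-inverse 0<α
  ... | β , 0<β , αβ≈1 = *-cancelˡ-nonneg 0<β (≤-respʳ (trans (eval-affine z X) (z· (lift X)))
    (X∈TH₁ f (affine-degree z) (1 , (λ _ → f) , (λ _ → affine-degree z) , f-f²∈I)))
    where
    z = λ x → β * y x
    f = affine z
    z· : ∀ a → z · a ≈ β * y · a
    z· a = trans (sum-cong-≋ λ x → *-assoc β (y x) (a x)) (sym (*-distribˡ-sum β (λ x → y x * a x)))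
    idempotent : ∀ {t} → t ≈ 0# ⊎ t ≈ 1# → t - t * t ≈ 0#
    idempotent (inj₁ t≈0) = trans (+-cong t≈0 (-‿cong (trans (*-congʳ t≈0) (zeroˡ _)))) (-‿inverseʳ 0#)
    idempotent {t} (inj₂ t≈1) = trans (+-congˡ (-‿cong (trans (*-congʳ t≈1) (*-identityˡ t)))) (-‿inverseʳ t)
    value : ∀ i → y · point i ≈ 0# ⊎ y · point i ≈ α → β * y · point i ≈ 0# ⊎ β * y · point i ≈ 1#
    value i (inj₁ ≈0) = inj₁ (trans (*-congˡ ≈0) (zeroʳ β))
    value i (inj₂ ≈α) = inj₂ (trans (*-congˡ ≈α) (trans (*-comm β α) αβ≈1))
    f-f²∈I : ∀ Y → A Y → ⟨ f List.++ ⊖ ∑ {n = 1} (λ _ → f ⊛ f) ∣ power (flat Y) ⟩ ≈ 0#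
    f-f²∈I Y (i , Y≈) = trans (pairing-++ f _ s) (trans (+-congˡ (trans (pairing-neg (∑ {n = 1} λ _ → f ⊛ f) s)
        (-‿cong (trans (pairing-∑ {r = 1} (λ _ → f ⊛ f) s) (trans (+-identityʳ _) (evaluate-* (flat Y) f f))))))
      (trans (+-cong f≈ (-‿cong (*-cong f≈ f≈))) (idempotent (value i (levels i)))))
      where
      s = power (flat Y)
      f≈ : ⟨ f ∣ s ⟩ ≈ β * y · point i
      f≈ = trans (eval-affine z Y) (trans (·-congʳ z (lift-perm i Y≈)) (z· (point i)))

  exchange⇒exact : Exchange → Exact ℝ σ
  exchange⇒exact exchange = conv⊆TH₁ , TH₁⊆conv
    where
    TH₁⊆conv : ∀ {X} → TH₁ ℝ {n} I X → conv ℝ A X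
    TH₁⊆conv {X} X∈TH₁ = [ cone⊆conv {X} , separated ]′ (farkas point (lift X))
      where
      separated : Separated point (lift X) → conv ℝ A X
      separated (y , y≥0 , yX<0) with two-level-separation exchange {lift X} y y≥0 yX<0
      ... | y′ , two-level , y′X<0 = contradiction (TH₁⊆two-level-halfspace {X} X∈TH₁ y′ two-level) y′X<0

-- The toric ideal

complexCommutativeRing : CompleteOrderedField → CommutativeRing 0ℓ 0ℓ
complexCommutativeRing ℝ = record
  { RawRing (complexRing ℝ)
  ; isCommutativeRing = record
    { isRing = record
      { +-isAbelianGroup = record
        { isGroup = record
          { isMonoid = record
            { isSemigroup = record
              { isMagma = record
                { isEquivalence = record
                  { refl  = refl , refl
                  ; sym   = λ (p , q) → sym p , sym q
                  ; trans = λ (p , q) (r , s) → trans p r , trans q s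
                  }
                ; ∙-cong = λ (p , q) (r , s) → +-cong p r , +-cong q s
                }
              ; assoc = λ _ _ _ → +-assoc _ _ _ , +-assoc _ _ _
              }
            ; identity = (λ _ → +-identityˡ _ , +-identityˡ _) , (λ _ → +-identityʳ _ , +-identityʳ _)
            }
          ; inverse = (λ _ → -‿inverseˡ _ , -‿inverseˡ _) , (λ _ → -‿inverseʳ _ , -‿inverseʳ _)
          ; ⁻¹-cong = λ (p , q) → -‿cong p , -‿cong q
          }
        ; comm = λ _ _ → +-comm _ _ , +-comm _ _
        }
      ; *-cong = λ (p , q) (r , s) →
          +-cong (*-cong p r) (-‿cong (*-cong q s)) , +-cong (*-cong p s) (*-cong q r)
      ; *-assoc = λ (a , b) (c , d) (e , f) →
          solve 6 (λ a b c d e f → (a :* c :- b :* d) :* e :- (a :* d :+ b :* c) :* f :=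
            a :* (c :* e :- d :* f) :- b :* (c :* f :+ d :* e)) refl a b c d e f ,
          solve 6 (λ a b c d e f → (a :* c :- b :* d) :* f :+ (a :* d :+ b :* c) :* e :=
            a :* (c :* f :+ d :* e) :+ b :* (c :* e :- d :* f)) refl a b c d e f
      ; *-identity = (λ (a , b) → 1*ˡ a b , 1*ʳ b a) ,
          (λ (a , b) → trans (+-cong (*-comm a 1#) (-‿cong (*-comm b 0#))) (1*ˡ a b) ,
                       trans (trans (+-comm _ _) (+-cong (*-comm b 1#) (*-comm a 0#))) (1*ʳ b a))
      ; distrib = (λ (a , b) (c , d) (e , f) →
          solve 6 (λ a b c d e f → a :* (c :+ e) :- b :* (d :+ f) := (a :* c :- b :* d) :+ (a :* e :- b :* f))
            refl a b c d e f ,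
          solve 6 (λ a b c d e f → a :* (d :+ f) :+ b :* (c :+ e) := (a :* d :+ b :* c) :+ (a :* f :+ b :* e))
            refl a b c d e f) ,
          (λ (a , b) (c , d) (e , f) →
          solve 6 (λ a b c d e f → (c :+ e) :* a :- (d :+ f) :* b := (c :* a :- d :* b) :+ (e :* a :- f :* b))
            refl a b c d e f ,
          solve 6 (λ a b c d e f → (c :+ e) :* b :+ (d :+ f) :* a := (c :* b :+ d :* a) :+ (e :* b :+ f :* a))
            refl a b c d e f)
      }
    ; *-comm = λ (a , b) (c , d) →
        solve 4 (λ a b c d → a :* c :- b :* d := c :* a :- d :* b) refl a b c d ,
        solve 4 (λ a b c d → a :* d :+ b :* c := c :* b :+ d :* a) refl a b c d
    }
  }
  where
  open CompleteOrderedField ℝ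
  open IntegerCoefficients commutativeRing
  open Solver
  1*ˡ : ∀ a b → 1# * a - 0# * b ≈ a
  1*ˡ a b = trans (+-cong (*-identityˡ a) (-‿cong (zeroˡ b))) (trans (+-congˡ -0#≈0#) (+-identityʳ a))
    where open import Algebra.Properties.Ring ring using (-0#≈0#)
  1*ʳ : ∀ a b → 1# * a + 0# * b ≈ a
  1*ʳ a b = trans (+-cong (*-identityˡ a) (zeroˡ b)) (+-identityʳ a)

open SemiringSum ℕ.+-*-semiring using () renaming (sum to sumℕ; sum-cong-≋ to sumℕ-cong; *-distribˡ-sum to *-distribˡ-sumℕ)
open SemiringIndicators ℕ.+-*-semiring using () renaming (bit to bitℕ; sum-indicator to sumℕ-indicator)

module MonomialProducts (K : CommutativeRing 0ℓ 0ℓ) {N : ℕ} where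
  open CommutativeRing K hiding (zero)
  open Pairing K
  open SemiringOps (RawRing.rawSemiring (polyRing N)) using (product; _^_)

  -- Products of one-term lists are again one-term lists, so this shape can be tracked by
  -- propositional equality; only the coefficient needs the equality of the ring.
  HasExponents : Poly N → (Fin N → ℕ) → Set
  HasExponents p φ = ∃[ c ] ∃[ e ] p ≡ (c , e) ∷ [] × c ≈ 1# × (∀ x → lookup e x ≡ φ x)

  exponents-1 : HasExponents (constant 1#) (λ _ → 0)
  exponents-1 = 1# , replicate N 0 , ≡.refl , refl , λ x → Vec.lookup-replicate x 0

  exponents-* : ∀ {p q φ ψ} → HasExponents p φ → HasExponents q ψ → HasExponents (p ⊛ q) (λ x → φ x ℕ.+ ψ x)
  exponents-* (c , e , ≡.refl , c≈1 , e≗φ) (c′ , e′ , ≡.refl , c′≈1 , e′≗ψ) =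
    c * c′ , e ∙ e′ , ≡.refl , trans (*-cong c≈1 c′≈1) (*-identityˡ 1#) ,
    λ x → ≡.trans (Vec.lookup-zipWith ℕ._+_ x e e′) (≡.cong₂ ℕ._+_ (e≗φ x) (e′≗ψ x))

  exponents-^ : ∀ {p φ} → HasExponents p φ → ∀ m → HasExponents (p ^ m) (λ x → m ℕ.* φ x)
  exponents-^ hp zero    = exponents-1
  exponents-^ hp (suc m) = exponents-* hp (exponents-^ hp m)

  exponents-product : ∀ {r} {f : Fin r → Poly N} {φ : Fin r → Fin N → ℕ} → (∀ i → HasExponents (f i) (φ i)) →
    HasExponents (product f) (λ x → sumℕ (λ i → φ i x))
  exponents-product {zero}  hf = exponents-1
  exponents-product {suc r} hf = exponents-* (hf zero) (exponents-product (hf ∘ suc))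

  exponents-var : ∀ v → HasExponents (var v) (λ x → bitℕ (does (x Fin.≟ v)))
  exponents-var v = 1# , _ , ≡.refl , refl , λ x → lookup-unit x (x Fin.≟ v)
    where
    lookup-unit : ∀ x (x? : Dec (x ≡ v)) → lookup (replicate N 0 [ v ]≔ 1) x ≡ bitℕ (does x?)
    lookup-unit x (yes ≡.refl) = Vec.lookup∘update v (replicate N 0) 1
    lookup-unit x (no x≢v)     = ≡.trans (Vec.lookup∘update′ x≢v (replicate N 0) 1) (Vec.lookup-replicate x 0)

module Fibers {d n : ℕ} (σ : Fin d → Permutation′ n) where
  open PermutationPoints σ

  permℕ : Fin d → Fin n → Fin n → ℕ
  permℕ i = permMatrix ℕ.+-*-rawSemiring (σ i)

  -- The exponents of the image of a single variable, as the double sum that `exponents-product`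
  -- yields for the double product defining `imageVar`.
  generator : Fin d → Fin (n ℕ.* n) → ℕ
  generator i x = sumℕ λ j → sumℕ λ k → permℕ i j k ℕ.* bitℕ (does (x Fin.≟ combine j k))

  exponent : Monomial d → Fin (n ℕ.* n) → ℕ
  exponent e x = sumℕ λ i → lookup e i ℕ.* generator i x

  generator-combine : ∀ i j k → generator i (combine j k) ≡ permℕ i j k
  generator-combine i j k = ≡.trans
    (sumℕ-cong λ j′ → ≡.trans (sumℕ-cong λ k′ → term j′ k′)
      (≡.sym (*-distribˡ-sumℕ {n} (bitℕ (does (j′ Fin.≟ j))) (λ k′ → bitℕ (does (k′ Fin.≟ k)) ℕ.* permℕ i j′ k′))))
    (≡.trans (sumℕ-indicator j (λ j′ → sumℕ λ k′ → bitℕ (does (k′ Fin.≟ k)) ℕ.* permℕ i j′ k′))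
      (sumℕ-indicator k (permℕ i j)))
    where
    term : ∀ j′ k′ → permℕ i j′ k′ ℕ.* bitℕ (does (combine j k Fin.≟ combine j′ k′)) ≡
      bitℕ (does (j′ Fin.≟ j)) ℕ.* (bitℕ (does (k′ Fin.≟ k)) ℕ.* permℕ i j′ k′)
    term j′ k′ with j′ Fin.≟ j | k′ Fin.≟ k
    ... | yes ≡.refl | yes ≡.refl rewrite dec-true (combine j k Fin.≟ combine j k) ≡.refl =
      ≡.trans (ℕ.*-identityʳ _) (≡.sym (≡.trans (ℕ.*-identityˡ _) (ℕ.*-identityˡ _)))
    ... | yes ≡.refl | no k′≢k rewrite dec-false (combine j k Fin.≟ combine j k′)
          (k′≢k ∘ ≡.sym ∘ proj₂ ∘ Fin.combine-injective j k j k′) = ℕ.*-zeroʳ (permℕ i j k′)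
    ... | no j′≢j | _ rewrite dec-false (combine j k Fin.≟ combine j′ k′)
          (j′≢j ∘ ≡.sym ∘ proj₁ ∘ Fin.combine-injective j k j′ k′) = ℕ.*-zeroʳ (permℕ i j′ k′)

  +-sum : ∀ {r} (f : Fin r → ℕ) → + sumℕ f ≡ sumℤ (+_ ∘ f)
  +-sum {zero}  f = ≡.refl
  +-sum {suc r} f = ≡.cong (λ t → + f zero ℤ.+ t) (+-sum (f ∘ suc))

  exponent-entry : ∀ e j k → + exponent e (combine j k) ≡ entry (lookup e) j k
  exponent-entry e j k = ≡.trans (+-sum (λ i → lookup e i ℕ.* generator i (combine j k)))
    (sumℤ-cong λ i → ≡.trans
      (≡.cong (λ t → + (lookup e i ℕ.* t)) (generator-combine i j k))
      (≡.trans (ℤ.pos-* (lookup e i) (permℕ i j k))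
        (≡.cong (λ t → + lookup e i ℤ.* t) (+bit (does (σ i ⟨$⟩ʳ k Fin.≟ j))))))

  infix 4 _∼_
  -- Lying in the same fibre of the toric map: both monomials have the same image.
  _∼_ : Monomial d → Monomial d → Set
  e ∼ e′ = ∀ j k → entry (lookup e) j k ≡ entry (lookup e′) j k

  ∼⇒exponent : ∀ {e e′} → e ∼ e′ → ∀ x → exponent e x ≡ exponent e′ x
  ∼⇒exponent {e} {e′} e∼e′ x = ≡.subst (λ x → exponent e x ≡ exponent e′ x) (Fin.combine-remQuot {n} n x)
    (uncurry (λ j k → ℤ.+-injective (≡.trans (exponent-entry e j k)
      (≡.trans (e∼e′ j k) (≡.sym (exponent-entry e′ j k))))) (remQuot {n} n x))

  exponent⇒∼ : ∀ {e e′} → (∀ x → exponent e x ≡ exponent e′ x) → e ∼ e′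
  exponent⇒∼ {e} {e′} eq j k = ≡.trans (≡.sym (exponent-entry e j k))
    (≡.trans (≡.cong +_ (eq (combine j k))) (exponent-entry e′ j k))

  module _ (ℝ : CompleteOrderedField) where
    open CommutativeRing (complexCommutativeRing ℝ) hiding (zero)
    open Pairing (complexCommutativeRing ℝ)
    open MonomialProducts (complexCommutativeRing ℝ) {n ℕ.* n}
    open SemiringIndicators semiring using (bit)
    open SemiringOps (RawRing.rawSemiring (polyRing (n ℕ.* n))) using (product; _^_)

    imageVar : Fin d → Poly (n ℕ.* n)
    imageVar i = product λ j → product λ k → var (combine j k) ^ permℕ i j k

    -- The toric map sends monomials to monomials, so a coefficient of the image adds up the
    -- coefficients of p over a fibre.
    coefficient-toricMap : ∀ p m → coefficient (toricMap ℝ σ p) m ≈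
      ⟨ p ∣ (λ e → bit (does (tabulate (exponent e) ≟ᵐ m))) ⟩
    coefficient-toricMap []            m = refl
    coefficient-toricMap ((c , e) ∷ p) m = step (product λ i → imageVar i ^ lookup e i)
      (exponents-product λ i → exponents-^ (exponents-product λ j → exponents-product λ k →
        exponents-^ (exponents-var (combine j k)) (permℕ i j k)) (lookup e i))
      where
      step : ∀ q → HasExponents q (exponent e) →
        coefficient ((constant c ⊛ q) List.++ toricMap ℝ σ p) m ≈
        c * bit (does (tabulate (exponent e) ≟ᵐ m)) + ⟨ p ∣ (λ e → bit (does (tabulate (exponent e) ≟ᵐ m))) ⟩
      step _ (c′ , e′ , ≡.refl , c′≈1 , e′≗) = trans (coefficient≈ ((c * c′ , replicate _ 0 ∙ e′) ∷ toricMap ℝ σ p) m)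
        (+-cong (*-cong (trans (*-congˡ c′≈1) (*-identityʳ c))
            (reflexive (≡.cong (λ e → bit (does (e ≟ᵐ m))) (≡.trans (Vec.zipWith-identityˡ ℕ.+-identityˡ e′)
              (≡.trans (≡.sym (Vec.tabulate∘lookup e′)) (Vec.tabulate-cong e′≗))))))
          (trans (sym (coefficient≈ (toricMap ℝ σ p) m)) (coefficient-toricMap p m)))

-- Quadratic Gröbner bases

lookup≤degree : ∀ {k} (e : Monomial k) i → lookup e i ℕ.≤ degree e
lookup≤degree (x ∷ e) zero    = ℕ.m≤m+n x (degree e)
lookup≤degree (x ∷ e) (suc i) = ℕ.≤-trans (lookup≤degree e i) (ℕ.m≤n+m (degree e) x)

lookup+lookup≤degree : ∀ {k} (e : Monomial k) {i l} → i ≢ l → lookup e i ℕ.+ lookup e l ℕ.≤ degree e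
lookup+lookup≤degree (x ∷ e) {zero}  {zero}  i≢l = contradiction ≡.refl i≢l
lookup+lookup≤degree (x ∷ e) {zero}  {suc l} _   = ℕ.+-monoʳ-≤ x (lookup≤degree e l)
lookup+lookup≤degree (x ∷ e) {suc i} {zero}  _   =
  ℕ.≤-trans (ℕ.≤-reflexive (ℕ.+-comm (lookup e i) x)) (ℕ.+-monoʳ-≤ x (lookup≤degree e i))
lookup+lookup≤degree (x ∷ e) {suc i} {suc l} i≢l =
  ℕ.≤-trans (lookup+lookup≤degree e (i≢l ∘ ≡.cong suc)) (ℕ.m≤n+m (degree e) x)

degree-concentrated : ∀ {k} (e : Monomial k) i → (∀ l → l ≢ i → lookup e l ≡ 0) → degree e ≡ lookup e i
degree-concentrated (x ∷ e) zero 0-off = ≡.trans (≡.cong (x ℕ.+_) (degree-zero e λ l → 0-off (suc l) λ ()))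
  (ℕ.+-identityʳ x)
  where
  degree-zero : ∀ {k} (e : Monomial k) → (∀ l → lookup e l ≡ 0) → degree e ≡ 0
  degree-zero []      _   = ≡.refl
  degree-zero (x ∷ e) all = ≡.cong₂ ℕ._+_ (all zero) (degree-zero e (all ∘ suc))
degree-concentrated (x ∷ e) (suc i) 0-off = ≡.cong₂ ℕ._+_ (0-off zero λ ())
  (degree-concentrated e i λ l l≢i → 0-off (suc l) (l≢i ∘ Fin.suc-injective))

lookup-ext : ∀ {k} {e e′ : Monomial k} → (∀ i → lookup e i ≡ lookup e′ i) → e ≡ e′
lookup-ext {e = e} {e′} eq =
  ≡.trans (≡.sym (Vec.tabulate∘lookup e)) (≡.trans (Vec.tabulate-cong eq) (Vec.tabulate∘lookup e′))

-- Base-(D+1) digits, the last one being the leading one.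
number : ∀ {k} → ℕ → (Fin k → ℕ) → ℕ
number {zero}  D x = 0
number {suc k} D x = x zero ℕ.+ suc D ℕ.* number D (x ∘ suc)

number-cong : ∀ {k} D {x y : Fin k → ℕ} → (∀ i → x i ≡ y i) → number D x ≡ number D y
number-cong {zero}  D x≗y = ≡.refl
number-cong {suc k} D x≗y = ≡.cong₂ (λ a b → a ℕ.+ suc D ℕ.* b) (x≗y zero) (number-cong D (x≗y ∘ suc))

-- The digits of x below i are at most D, so together they weigh less than one unit of digit i.
number-< : ∀ {k} D {x y : Fin k → ℕ} → (∀ i → x i ℕ.≤ D) → ∀ i → x i ℕ.< y i →
           (∀ j → i Fin.< j → x j ≡ y j) → number D x ℕ.< number D y
number-< D {x} {y} x≤D zero x₀<y₀ above = ℕ.+-mono-<-≤ x₀<y₀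
  (ℕ.≤-reflexive (≡.cong (suc D ℕ.*_) (number-cong D λ j → above (suc j) (s≤s z≤n))))
number-< D {x} {y} x≤D (suc i) xᵢ<yᵢ above = begin-strict
  x zero ℕ.+ suc D ℕ.* number D (x ∘ suc)  <⟨ ℕ.+-monoˡ-< _ (s≤s (x≤D zero)) ⟩
  suc D ℕ.+ suc D ℕ.* number D (x ∘ suc)   ≡⟨ ℕ.*-suc (suc D) _ ⟨
  suc D ℕ.* suc (number D (x ∘ suc))       ≤⟨ ℕ.*-monoʳ-≤ (suc D) (number-< D (x≤D ∘ suc) i xᵢ<yᵢ
                                                λ j i<j → above (suc j) (s≤s i<j)) ⟩
  suc D ℕ.* number D (y ∘ suc)             ≤⟨ ℕ.m≤n+m _ (y zero) ⟩
  y zero ℕ.+ suc D ℕ.* number D (y ∘ suc)  ∎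
  where open ℕ.≤-Reasoning

-- Embeds the monomials of degree D, ordered reverse lexicographically, into ℕ and so shows that
-- reduction terminates. Exponents are complemented because a larger exponent at the last difference
-- makes a monomial smaller; none exceeds D.
rank : ∀ {k} → Permutation′ k → ℕ → Monomial k → ℕ
rank ρ D e = number D λ i → D ℕ.∸ lookup e (ρ ⟨$⟩ʳ i)

revLex⇒rank-< : ∀ {k} (ρ : Permutation′ k) D {a b} → degree a ≡ D → degree b ≡ D → revLex ρ a b →
  rank ρ D a ℕ.< rank ρ D b
revLex⇒rank-< ρ D a≡D b≡D (inj₁ a<b) = contradiction (≡.trans a≡D (≡.sym b≡D)) (ℕ.<⇒≢ a<b)
revLex⇒rank-< ρ D {a} a≡D b≡D (inj₂ (_ , i , bᵢ<aᵢ , above)) = number-< D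
  (λ j → ℕ.m∸n≤m D (lookup a (ρ ⟨$⟩ʳ j))) i
  (ℕ.∸-monoʳ-< bᵢ<aᵢ (≡.subst (lookup a (ρ ⟨$⟩ʳ i) ℕ.≤_) a≡D (lookup≤degree a _)))
  (λ j i<j → ≡.cong (D ℕ.∸_) (above j i<j))

module GröbnerBases (K : CommutativeRing 0ℓ 0ℓ) where
  open CommutativeRing K hiding (zero)
  open Pairing K
  open SemiringIndicators semiring using (bit)
  open SemiringSum semiring using (sum-cong-≋; sum-replicate-zero)

  at-≡ : ∀ {k} {e m : Monomial k} → e ≡ m → at m e ≈ 1#
  at-≡ {e = e} {m} e≡m = reflexive (≡.cong bit (dec-true (e ≟ᵐ m) e≡m))

  at-≢ : ∀ {k} {e m : Monomial k} → e ≢ m → at m e ≈ 0#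
  at-≢ {e = e} {m} e≢m = reflexive (≡.cong bit (dec-false (e ≟ᵐ m) e≢m))

  coefficient-monomial : ∀ {k} (m : Monomial k) → coefficient (monomial m) m ≈ 1#
  coefficient-monomial m = trans (coefficient≈ (monomial m) m) (trans (+-identityʳ _)
    (trans (*-identityˡ _) (at-≡ {e = m} ≡.refl)))

  coefficient-monomial-≢ : ∀ {k} {m m′ : Monomial k} → m ≢ m′ → coefficient (monomial m) m′ ≈ 0#
  coefficient-monomial-≢ {m = m} {m′} m≢m′ = trans (coefficient≈ (monomial m) m′) (trans (+-identityʳ _)
    (trans (*-identityˡ _) (at-≢ m≢m′)))

  initial⇒monomial∈ : ∀ {k} (_≺_ : Monomial k → Monomial k → Set) (S : Poly k → Set) f m →
    S f → IsInitialMonomial _≺_ f m → initialIdeal _≺_ S (monomial m)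
  initial⇒monomial∈ {k} _≺_ S f m f∈S init = 1 , (λ _ → constant 1#) , (λ _ → monomial m) ,
    (λ _ → f , f∈S , m , init , λ _ → refl) , λ m′ → trans (coefficient≈ (monomial m) m′)
      (trans (+-congʳ (*-cong (sym (*-identityʳ 1#))
        (reflexive (≡.cong (λ e → at m′ e) (≡.sym (Vec.zipWith-identityˡ ℕ.+-identityˡ m))))))
        (sym (coefficient≈ ((1# * 1# , replicate k 0 ∙ m) ∷ []) m′)))

  module _ (_≟_ : Decidable _≈_) (1≉0 : ¬ 1# ≈ 0#) {k : ℕ} (_≺_ : Monomial k → Monomial k → Set) where

    -- The generators are monomials up to equality of coefficients. If none of them divided A, then
    -- A would have coefficient zero in every multiple of every generator.
    monomial∈⇒divisible : ∀ (S : Poly k → Set) A → initialIdeal _≺_ S (monomial A) →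
      ∃[ f ] S f × ∃[ m ] IsInitialMonomial _≺_ f m × (∀ i → lookup m i ℕ.≤ lookup A i)
    monomial∈⇒divisible S A (r , q , h , h∈ , eq)
      with Fin.any? (λ i → Fin.all? (λ x → lookup (proj₁ (proj₂ (proj₂ (h∈ i)))) x ℕ.≤? lookup A x))
    ... | yes (i , m≤A) = let f , f∈S , m , init , _ = h∈ i in f , f∈S , m , init , m≤A
    ... | no none = contradiction (trans (sym (coefficient-monomial A)) (trans (eq A) ∑≈0)) 1≉0
      where
      m = λ i → proj₁ (proj₂ (proj₂ (h∈ i)))
      h≈m : ∀ i e → coefficient (h i) e ≈ coefficient (monomial (m i)) e
      h≈m i = proj₂ (proj₂ (proj₂ (proj₂ (h∈ i))))
      inner : ∀ i e → ⟨ h i ∣ (λ e′ → at A (e ∙ e′)) ⟩ ≈ 0#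
      inner i e with nonzero-term _≟_ (h i) (λ e′ → at A (e ∙ e′))
      ... | inj₂ ≈0 = ≈0
      ... | inj₁ (e′ , occurs , at≉0) = contradiction (i , m≤A) none
        where
        m≡e′ : m i ≡ e′
        m≡e′ = decidable-stable (m i ≟ᵐ e′) λ m≢e′ → occurs (trans (h≈m i e′) (coefficient-monomial-≢ m≢e′))
        e∙e′≡A : e ∙ e′ ≡ A
        e∙e′≡A = decidable-stable (e ∙ e′ ≟ᵐ A) λ ≢A → at≉0 (at-≢ ≢A)
        m≤A : ∀ x → lookup (m i) x ℕ.≤ lookup A x
        m≤A x rewrite m≡e′ | ≡.sym e∙e′≡A | Vec.lookup-zipWith ℕ._+_ x e e′ = ℕ.m≤n+m (lookup e′ x) (lookup e x)
      ∑≈0 : coefficient (∑ λ i → q i ⊛ h i) A ≈ 0#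
      ∑≈0 = trans (coefficient≈ (∑ λ i → q i ⊛ h i) A) (trans (pairing-∑ (λ i → q i ⊛ h i) (at A))
        (trans (sum-cong-≋ λ i → trans (pairing-* (q i) (h i) (at A))
            (trans (pairing-cong (q i) (inner i)) (pairing-0 (q i))))
          (sum-replicate-zero r)))

module Toric (ℝ : CompleteOrderedField) {d n : ℕ} (σ : Fin d → Permutation′ n)
             (distinct : ∀ i j → σ i Perm.≈ σ j → i ≡ j) (k₀ : Fin n) where
  open PermutationPoints σ
  open Fibers σ
  open CommutativeRing (complexCommutativeRing ℝ) hiding (zero)
  open Pairing (complexCommutativeRing ℝ)
  open GröbnerBases (complexCommutativeRing ℝ)
  open SemiringIndicators semiring using (bit)

  private
    module R = CompleteOrderedField ℝ

  _≟ᶜ_ : Decidable _≈_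
  (x , y) ≟ᶜ (u , v) = (x ≟ʳ u) ×-dec (y ≟ʳ v)
    where open IsDecTotalOrder R.isDecTotalOrder using () renaming (_≟_ to _≟ʳ_)

  1≉0 : ¬ 1# ≈ 0#
  1≉0 (1≈0 , _) = R.1≉0 1≈0

  degree-entry : ∀ {k} (e : Monomial k) → sumℤ (λ i → + lookup e i ℤ.* ℤ.1ℤ) ≡ + degree e
  degree-entry []      = ≡.refl
  degree-entry (x ∷ e) = ≡.cong₂ ℤ._+_ (ℤ.*-identityʳ (+ x)) (degree-entry e)

  ∼⇒degree : ∀ {e e′} → e ∼ e′ → degree e ≡ degree e′
  ∼⇒degree {e} {e′} e∼e′ = ℤ.+-injective (≡.trans (≡.sym (degree-entry e)) (≡.trans (≡.sym (column-sum (lookup e) k₀))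
    (≡.trans (sumℤ-cong λ j → e∼e′ j k₀)
      (≡.trans (column-sum (lookup e′) k₀) (degree-entry e′)))))

  ∙-∼ : ∀ r {m m′} → m ∼ m′ → r ∙ m ∼ r ∙ m′
  ∙-∼ r {m} {m′} m∼m′ j k = ≡.trans (expand m)
    (≡.trans (≡.cong (λ t → entry (lookup r) j k ℤ.+ t) (m∼m′ j k)) (≡.sym (expand m′)))
    where
    expand : ∀ e → entry (lookup (r ∙ e)) j k ≡ entry (lookup r) j k ℤ.+ entry (lookup e) j k
    expand e = ≡.trans (entry-cong (λ x → Vec.lookup-zipWith ℕ._+_ x r e) j k) (entry-+ (lookup r) (lookup e) j k)

  -- If e is a power of one variable, the common matrix is supported where σ i has its ones. A
  -- permutation taking part in e′ has its ones there as well, hence is σ i.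
  concentrated : ∀ {e e′} i → e ∼ e′ → (∀ l → l ≢ i → lookup e l ≡ 0) → ∀ l → l ≢ i → lookup e′ l ≡ 0
  concentrated {e} {e′} i e∼e′ 0-off l l≢i = decidable-stable (lookup e′ l ℕ.≟ 0) λ e′ₗ≢0 →
    l≢i (distinct l i λ k → decidable-stable (σ l ⟨$⟩ʳ k Fin.≟ σ i ⟨$⟩ʳ k) λ σₗk≢σᵢk →
      Z.sum-positive (λ x → + lookup e′ x ℤ.* permℤ x (σ l ⟨$⟩ʳ k) k) (nonneg k) l (positive e′ₗ≢0 k)
        (ℤ.≤-reflexive (≡.trans (≡.sym (e∼e′ (σ l ⟨$⟩ʳ k) k)) (entry-zero k σₗk≢σᵢk))))
    where
    nonneg : ∀ k x → ℤ.0ℤ ℤ.≤ + lookup e′ x ℤ.* permℤ x (σ l ⟨$⟩ʳ k) k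
    nonneg k x with does (σ x ⟨$⟩ʳ k Fin.≟ σ l ⟨$⟩ʳ k)
    ... | true  = ≡.subst (ℤ.0ℤ ℤ.≤_) (≡.sym (ℤ.*-identityʳ (+ lookup e′ x))) (ℤ.+≤+ z≤n)
    ... | false = ℤ.≤-reflexive (≡.sym (ℤ.*-zeroʳ (+ lookup e′ x)))
    positive : lookup e′ l ≢ 0 → ∀ k → ¬ + lookup e′ l ℤ.* permℤ l (σ l ⟨$⟩ʳ k) k ℤ.≤ ℤ.0ℤ
    positive e′ₗ≢0 k rewrite dec-true (σ l ⟨$⟩ʳ k Fin.≟ σ l ⟨$⟩ʳ k) ≡.refl | ℤ.*-identityʳ (+ lookup e′ l) =
      λ e′ₗ≤0 → e′ₗ≢0 (ℕ.n≤0⇒n≡0 (ℤ.drop‿+≤+ e′ₗ≤0))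
    entry-zero : ∀ k → σ l ⟨$⟩ʳ k ≢ σ i ⟨$⟩ʳ k → entry (lookup e) (σ l ⟨$⟩ʳ k) k ≡ ℤ.0ℤ
    entry-zero k σₗk≢σᵢk = ≡.trans (sumℤ-cong λ x → term x (x Fin.≟ i)) (sumℤ-zero d)
      where
      term : ∀ x → Dec (x ≡ i) → + lookup e x ℤ.* permℤ x (σ l ⟨$⟩ʳ k) k ≡ ℤ.0ℤ
      term x (yes ≡.refl) rewrite dec-false (σ i ⟨$⟩ʳ k Fin.≟ σ l ⟨$⟩ʳ k) (σₗk≢σᵢk ∘ ≡.sym) = ℤ.*-zeroʳ (+ lookup e i)
      term x (no x≢i) rewrite 0-off x x≢i = ℤ.*-zeroˡ (permℤ x (σ l ⟨$⟩ʳ k) k)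

  module _ {_≺_ : Monomial d → Monomial d → Set} where

    binomial-initial : ∀ {A B} → A ∼ B → A ≢ B → B ≺ A → initialIdeal _≺_ (toricIdeal ℝ σ) (monomial A)
    binomial-initial {A} {B} A∼B A≢B B≺A =
      initial⇒monomial∈ _≺_ (toricIdeal ℝ σ) f A f∈I (occurs , λ m → initial m (A ≟ᵐ m) (B ≟ᵐ m))
      where
      f : Poly d
      f = (1# , A) ∷ (- 1# , B) ∷ []
      pairing-f : ∀ g → ⟨ f ∣ g ⟩ ≈ g A + - 1# * g B
      pairing-f g = +-cong (*-identityˡ _) (+-identityʳ _)
      f∈I : toricIdeal ℝ σ f
      f∈I m = trans (coefficient-toricMap ℝ f m) (trans (pairing-f h)
        (trans (+-cong (sym (*-identityˡ (h A))) (*-congˡ (sym hA≈hB)))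
          (trans (sym (distribʳ (h A) 1# (- 1#))) (trans (*-congʳ (-‿inverseʳ 1#)) (zeroˡ (h A))))))
        where
        h = λ e → bit (does (tabulate (exponent e) ≟ᵐ m))
        hA≈hB : h A ≈ h B
        hA≈hB = reflexive (≡.cong (λ e → bit (does (e ≟ᵐ m))) (Vec.tabulate-cong (∼⇒exponent {A} {B} A∼B)))
      occurs : Occurs f A
      occurs f[A]≈0 = 1≉0 (trans (sym (trans (+-cong (at-≡ {e = A} ≡.refl) (trans (*-congˡ (at-≢ (A≢B ∘ ≡.sym))) (zeroʳ _)))
        (+-identityʳ 1#))) (trans (sym (trans (coefficient≈ f A) (pairing-f (at A)))) f[A]≈0))
      initial : ∀ m → Dec (A ≡ m) → Dec (B ≡ m) → Occurs f m → m ≡ A ⊎ m ≺ A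
      initial m (yes A≡m) _ _ = inj₁ (≡.sym A≡m)
      initial m (no _) (yes ≡.refl) _ = inj₂ B≺A
      initial m (no A≢m) (no B≢m) occurs = contradiction f[m]≈0 occurs
        where
        f[m]≈0 : coefficient f m ≈ 0#
        f[m]≈0 = trans (coefficient≈ f m) (trans (pairing-f (at m)) (trans (+-cong (at-≢ A≢m)
          (trans (*-congˡ (at-≢ B≢m)) (zeroʳ _))) (+-identityʳ 0#)))

    -- The coefficients of g add up to zero over the fibre of m. That of m is nonzero, so another
    -- monomial of the fibre occurs in g, and it is lower because m is initial.
    lower-term : ∀ {g m} → toricIdeal ℝ σ g → IsInitialMonomial _≺_ g m →
      ∃[ m′ ] m′ ≢ m × m′ ≺ m × m′ ∼ m
    lower-term {g} {m} g∈I (occurs , initial) =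
      [ found , (λ ≈0 → contradiction (absurd ≈0) occurs) ]′ (nonzero-term _≟ᶜ_ g other)
      where
      image = λ e → tabulate (exponent e)
      other? : ∀ e → Dec (image e ≡ image m × e ≢ m)
      other? e = (image e ≟ᵐ image m) ×-dec ¬? (e ≟ᵐ m)
      other = λ e → bit (does (other? e))
      found : ∃[ e ] Occurs g e × ¬ other e ≈ 0# → ∃[ m′ ] m′ ≢ m × m′ ≺ m × m′ ∼ m
      found (e , e∈g , other≉0) = e , e≢m , [ (λ e≡m → contradiction e≡m e≢m) , (λ e≺m → e≺m) ]′ (initial e e∈g) ,
        exponent⇒∼ {e} {m} λ x → ≡.trans (≡.sym (Vec.lookup∘tabulate (exponent e) x))
          (≡.trans (≡.cong (λ v → lookup v x) image≡) (Vec.lookup∘tabulate (exponent m) x))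
        where
        is-other : image e ≡ image m × e ≢ m
        is-other = decidable-stable (other? e) λ ¬other → other≉0 (reflexive (≡.cong bit (dec-false (other? e) ¬other)))
        image≡ = proj₁ is-other
        e≢m = proj₂ is-other
      split : ∀ e → bit (does (image e ≟ᵐ image m)) ≈ at m e + other e
      split e = split′ (image e ≟ᵐ image m) (e ≟ᵐ m)
        where
        split′ : (i? : Dec (image e ≡ image m)) (m? : Dec (e ≡ m)) →
          bit (does i?) ≈ bit (does m?) + bit (does (i? ×-dec ¬? m?))
        split′ (yes _) (yes _)      = sym (+-identityʳ 1#)
        split′ (yes _) (no _)       = sym (+-identityˡ 1#)
        split′ (no _)  (no _)       = sym (+-identityˡ 0#)
        split′ (no ≢)  (yes ≡.refl) = contradiction ≡.refl ≢
      absurd : ⟨ g ∣ other ⟩ ≈ 0# → coefficient g m ≈ 0#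
      absurd ≈0 = trans (coefficient≈ g m) (trans (sym (+-identityʳ _)) (trans (+-congˡ (sym ≈0))
        (trans (sym (pairing-+ g (at m) other)) (trans (sym (pairing-cong g split))
          (trans (sym (coefficient-toricMap ℝ g (image m))) (g∈I (image m)))))))

  -- An exponent of 2 or more would make m the square of a single variable. By `concentrated` m′ is
  -- then a power of the same variable, of the same degree, and equals m.
  squarefree : ∀ {m m′} → degree m ℕ.≤ 2 → m ∼ m′ → m′ ≢ m → ∀ i → lookup m i ℕ.≤ 1
  squarefree {m} {m′} m≤2 m∼m′ m′≢m i = decidable-stable (lookup m i ℕ.≤? 1) λ mᵢ≰1 →
    let off : ∀ l → l ≢ i → lookup m l ≡ 0
        off l l≢i = ℕ.n≤0⇒n≡0 (ℕ.+-cancelˡ-≤ 2 (lookup m l) 0 (ℕ.≤-trans (ℕ.+-monoˡ-≤ (lookup m l) (ℕ.≰⇒> mᵢ≰1))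
          (ℕ.≤-trans (lookup+lookup≤degree m (l≢i ∘ ≡.sym)) m≤2)))
        off′ = concentrated {m} {m′} i m∼m′ off
    in m′≢m (lookup-ext λ l → case l Fin.≟ i of λ
      { (yes ≡.refl) → ≡.trans (≡.sym (degree-concentrated m′ i off′))
          (≡.trans (≡.sym (∼⇒degree {m} {m′} m∼m′)) (degree-concentrated m i off))
      ; (no l≢i) → ≡.trans (off′ l l≢i) (≡.sym (off l l≢i)) })

  module _ (ρ : Permutation′ d) (quadratic : HasQuadraticGröbnerBasis (revLex ρ) (toricIdeal ℝ σ)) where

    -- The monomial A leads a binomial of the ideal, so the leading monomial m of some quadric
    -- divides it. Only m and a lower monomial m′ of its fibre in that quadric are kept: they
    -- already give a rewriting rule that respects fibres.
    reducible : ∀ A B → A ∼ B → A ≢ B → revLex ρ B A →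
      ∃[ m ] ∃[ m′ ] (∀ i → lookup m i ℕ.≤ lookup A i) × (∀ i → lookup m i ℕ.≤ 1) × revLex ρ m′ m × m′ ∼ m
    reducible A B A∼B A≢B B≺A =
      let G , (G⊆I , _ , I⊆G) , G-quadratic = quadratic
          g , g∈G , m , initial , m≤A = monomial∈⇒divisible _≟ᶜ_ 1≉0 (revLex ρ) (_∈ G) A
            (I⊆G {monomial A} (binomial-initial {revLex ρ} {A} {B} A∼B A≢B B≺A))
          m′ , m′≢m , m′≺m , m′∼m = lower-term {revLex ρ} {g} {m} (G⊆I g g∈G) initial
      in m , m′ , m≤A ,
         squarefree {m} {m′} (proj₁ (G-quadratic g g∈G) m (proj₁ initial)) (λ j k → ≡.sym (m′∼m j k)) m′≢m ,
         m′≺m , m′∼m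

    revLex-∙ : ∀ r {m m′} → m′ ∼ m → revLex ρ m′ m → revLex ρ (r ∙ m′) (r ∙ m)
    revLex-∙ r {m} {m′} m′∼m m′≺m = [ (λ m′<m → contradiction (∼⇒degree {m′} {m} m′∼m) (ℕ.<⇒≢ m′<m)) , shift ]′ m′≺m
      where
      look : ∀ e i → lookup (r ∙ e) i ≡ lookup r i ℕ.+ lookup e i
      look e i = Vec.lookup-zipWith ℕ._+_ i r e
      shift : _ → revLex ρ (r ∙ m′) (r ∙ m)
      shift (_ , i , mᵢ<m′ᵢ , above) = inj₂ (∼⇒degree {r ∙ m′} {r ∙ m} (∙-∼ r {m′} {m} m′∼m) , i ,
        ≡.subst₂ ℕ._<_ (≡.sym (look m _)) (≡.sym (look m′ _)) (ℕ.+-monoʳ-< (lookup r (ρ ⟨$⟩ʳ i)) mᵢ<m′ᵢ) ,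
        λ j i<j → ≡.trans (look m′ _) (≡.trans (≡.cong (lookup r (ρ ⟨$⟩ʳ j) ℕ.+_) (above j i<j)) (≡.sym (look m _))))

    -- While v does not divide u, the binomial of (k+1)u and b is reducible, and
    -- the reducing quadric, being squarefree, already applies to u.
    standard-splits : ∀ v i → ρ ⟨$⟩ʳ i ≡ v → (∀ (j : Fin d) → ¬ i Fin.< j) → ∀ k (a b : Monomial d) →
      (∀ j l → entry (λ x → suc k ℕ.* lookup a x) j l ≡ entry (lookup b) j l) → 0 ℕ.< lookup b v →
      ∃[ u ] a ∼ u × 0 ℕ.< lookup u v
    standard-splits v i ρi≡v i-top k a b ka∼b 0<bᵥ = go a (λ _ _ → ≡.refl) (<-wellFounded _)
      where
      D = degree a
      go : ∀ u → a ∼ u → Acc ℕ._<_ (rank ρ D u) → ∃[ u ] a ∼ u × 0 ℕ.< lookup u v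
      go u a∼u (acc rs) = step (0 ℕ.<? lookup u v)
        where
        A = Vec.map (suc k ℕ.*_) u
        A∼b : A ∼ b
        A∼b j l = ≡.trans (entry-cong (λ x → Vec.lookup-map x (suc k ℕ.*_) u) j l)
          (≡.trans (entry-scale (suc k) (lookup u) j l) (≡.trans (≡.cong (+ suc k ℤ.*_) (≡.sym (a∼u j l)))
            (≡.trans (≡.sym (entry-scale (suc k) (lookup a) j l)) (ka∼b j l))))
        step : Dec (0 ℕ.< lookup u v) → ∃[ u ] a ∼ u × 0 ℕ.< lookup u v
        step (yes 0<uᵥ) = u , a∼u , 0<uᵥ
        step (no 0≮uᵥ)  = go u′ a∼u′ (rs
          (revLex⇒rank-< ρ D {u′} {u} (≡.sym (∼⇒degree {a} {u′} a∼u′)) (≡.sym (∼⇒degree {a} {u} a∼u)) u′≺u))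
          where
          Aᵥ≡0 : lookup A v ≡ 0
          Aᵥ≡0 = ≡.trans (Vec.lookup-map v (suc k ℕ.*_) u)
            (≡.trans (≡.cong (suc k ℕ.*_) (ℕ.n≤0⇒n≡0 (ℕ.≮⇒≥ 0≮uᵥ))) (ℕ.*-zeroʳ (suc k)))
          -- The last variable decides: it divides b but not A, and no later variable can produce a
          -- tie to be checked.
          b≺A : revLex ρ b A
          b≺A = inj₂ (≡.sym (∼⇒degree {A} {b} A∼b) , i ,
            ≡.subst (λ x → lookup A x ℕ.< lookup b x) (≡.sym ρi≡v) (≡.subst (ℕ._< lookup b v) (≡.sym Aᵥ≡0) 0<bᵥ) ,
            λ j i<j → contradiction i<j (i-top j))
          red = reducible A b A∼b (λ A≡b → ℕ.<⇒≢ 0<bᵥ (≡.trans (≡.sym Aᵥ≡0) (≡.cong (λ e → lookup e v) A≡b))) b≺A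
          m = proj₁ red
          m′ = proj₁ (proj₂ red)
          m≤A = proj₁ (proj₂ (proj₂ red))
          m≤1 = proj₁ (proj₂ (proj₂ (proj₂ red)))
          m′≺m = proj₁ (proj₂ (proj₂ (proj₂ (proj₂ red))))
          m′∼m = proj₂ (proj₂ (proj₂ (proj₂ (proj₂ red))))
          m≤u : ∀ x → lookup m x ℕ.≤ lookup u x
          m≤u x = bound (lookup u x) ≡.refl
            where
            bound : ∀ uₓ → lookup u x ≡ uₓ → lookup m x ℕ.≤ uₓ
            bound zero uₓ≡0 = ℕ.≤-trans (m≤A x) (ℕ.≤-reflexive (≡.trans (Vec.lookup-map x (suc k ℕ.*_) u)
              (≡.trans (≡.cong (suc k ℕ.*_) uₓ≡0) (ℕ.*-zeroʳ (suc k)))))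
            bound (suc _) _ = ℕ.≤-trans (m≤1 x) (s≤s z≤n)
          -- The cofactor of m in u; truncated subtraction is exact because m divides u. Replacing m
          -- by m′ stays in the fibre and lowers the rank.
          r = zipWith ℕ._∸_ u m
          u′ = r ∙ m′
          r∙m≡u : r ∙ m ≡ u
          r∙m≡u = lookup-ext λ x → ≡.trans (Vec.lookup-zipWith ℕ._+_ x r m)
            (≡.trans (≡.cong (ℕ._+ lookup m x) (Vec.lookup-zipWith ℕ._∸_ x u m)) (ℕ.m∸n+n≡m (m≤u x)))
          a∼u′ : a ∼ u′
          a∼u′ j l = ≡.trans (a∼u j l) (≡.trans (≡.cong (λ e → entry (lookup e) j l) (≡.sym r∙m≡u))
            (≡.sym (∙-∼ r {m′} {m} m′∼m j l)))
          u′≺u : revLex ρ u′ u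
          u′≺u = ≡.subst (revLex ρ u′) r∙m≡u (revLex-∙ r {m} {m′} m′∼m m′≺m)

last-index : ∀ {d} → Fin d → Σ[ i ∈ Fin d ] (∀ (j : Fin d) → ¬ i Fin.< j)
last-index {suc d} _ = fromℕ d , λ j i<j → ℕ.<⇒≱ i<j (Fin.≤fromℕ j)

transpose-left : ∀ {d} (i j : Fin d) → Perm.transpose i j ⟨$⟩ʳ i ≡ j
transpose-left i j with i Fin.≟ i
... | yes _  = ≡.refl
... | no i≢i = contradiction ≡.refl i≢i

quadratic⇒exchange : (ℝ : CompleteOrderedField) {d n : ℕ} (σ : Fin d → Permutation′ n) →
  (∀ i j → σ i Perm.≈ σ j → i ≡ j) →
  (∀ (ρ : Permutation′ d) → Polynomial.HasQuadraticGröbnerBasis (complexRing ℝ) (revLex ρ) (toricIdeal ℝ σ)) →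
  Points.Exchange (homogeneous σ)
quadratic⇒exchange ℝ {d} {n} σ distinct quadratic {v} {w} w≢v k a b ka~b 0<bᵥ = split n ≡.refl
  where
  open PermutationPoints σ
  i = proj₁ (last-index v)
  split : ∀ n′ → n ≡ n′ → ∃[ u ] a ~ u × 0 ℕ.< u v
  split zero     ≡.refl = contradiction (distinct w v λ ()) w≢v
  split (suc n′) ≡.refl =
    -- The transposition puts v at the last, hence smallest, place of the ordering. Since n is
    -- positive there is a column 0 from which degrees can be read off.
    let u , a∼u , 0<uᵥ = standard-splits (Perm.transpose i v) (quadratic (Perm.transpose i v)) v i
          (transpose-left i v) (proj₂ (last-index v)) k (tabulate a) (tabulate b)
          (λ j l → ≡.trans (entry-cong (λ x → ≡.cong (suc k ℕ.*_) (Vec.lookup∘tabulate a x)) j l)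
            (≡.trans (~⇒entry (λ x → suc k ℕ.* a x) b ka~b j l) (entry-cong (λ x → ≡.sym (Vec.lookup∘tabulate b x)) j l)))
          (≡.subst (0 ℕ.<_) (≡.sym (Vec.lookup∘tabulate b v)) 0<bᵥ)
    in lookup u , entry⇒~ zero a (lookup u) (λ j l → ≡.trans
         (entry-cong (λ x → ≡.sym (Vec.lookup∘tabulate a x)) j l) (a∼u j l)) , 0<uᵥ
    where open Toric ℝ σ distinct zero

theorem4p6 : (ℝ : CompleteOrderedField) (d n : ℕ) (σ : Fin d → Permutation′ n) →
    IsPermutationGroup σ →
    (PermutationSummable σ → Exact ℝ σ) ×
    ((∀ (ρ : Permutation′ d) →
    Polynomial.HasQuadraticGröbnerBasis (complexRing ℝ) (revLex ρ) (toricIdeal ℝ σ)) →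
    Exact ℝ σ)
theorem4p6 ℝ d n σ group =
  (λ summable → exchange⇒exact (Summable.summable⇒exchange σ group summable)) ,
  (λ quadratic → exchange⇒exact (quadratic⇒exchange ℝ σ (IsPermutationGroup.distinct group) quadratic))
  where open Exactness ℝ σ
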